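{- Let $n\ge 1$ and $1<k\le 2n$. Suppose that for every 1D array of size $n$ there is an $S(n,k)$-bit encoding from which sorted 1-sided Top-$k$ queries can be answered in $T(n,k)$ time. Then every $2\times n$ array $A$ admits an encoding of $2S(n,k)+\lceil (n-\lfloor k/2\rfloor)\lg 3\rceil+o(n)$ bits from which every unsorted 3-sided Top-$k$ query on $A$ can be answered in $2T(n,k)+O(1)$ time.
   Context: All arrays have pairwise distinct entries from a totally ordered set. For a 1D array $B[1..n]$ and $1\le i\le j\le n$, the query Top-$k(i,j,B)$ returns the positions of the $k$ largest values of $B[i..j]$ (all positions of $B[i..j]$ if it has at most $k$ entries); a query is sorted if the positions must be reported in decreasing order of their values, unsorted if they may be reported in any order; 1-sided queries are those with $i=1$, 2-sided queries allow arbitrary $i\le j$. For an $m\times n$ array $A$, Top-$k(i,j,a,b,A)$ (with $1\le i\le j\le m$, $1\le a\le b\le n$) returns the positions of the $k$ largest values in the subarray $A[i..j][a..b]$ (rows $i..j$, columns $a..b$); 3-sided queries are those with $a=1$, 4-sided queries allow arbitrary $a\le b$. An $s$-bit encoding supporting a family of queries is a map assigning to each array a bit string of length at most $s$ such that every query of the family can be answered from this bit string alone, without access to the array. Running times are in the word-RAM model with word size $\Theta(\lg n)$; $\lg=\log_2$. -}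

module Defs where

open import Level using (Level; _⊔_)
open import Data.Bool.Base using (Bool; true; false; _∧_; _∨_; _xor_; if_then_else_)
open import Data.Nat.Base hiding (_⊔_)
open import Data.Nat.DivMod using (_mod_)
open import Data.Nat.Logarithm using (⌊log₂_⌋)
open import Data.Nat.Properties using (m^n≢0) renaming (_≟_ to _≟ℕ_)
open import Data.Fin.Base using (Fin; zero; suc; toℕ)
open import Data.Fin.Properties using () renaming (_≟_ to _≟F_)
open import Data.List.Base using (List; []; _∷_; _++_; length; lookup; map; take; drop; zipWith)
open import Data.List.Membership.Propositional using (_∈_; _∉_)
open import Data.List.Relation.Unary.All using (All)
open import Data.List.Relation.Unary.AllPairs using (AllPairs)
open import Data.List.Relation.Unary.Unique.Propositional using (Unique)
open import Data.Product.Base using (Σ; ∃; _×_; _,_; uncurry)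
open import Function.Definitions using (Injective)
open import Relation.Binary.Bundles using (StrictTotalOrder)
open import Relation.Binary.Definitions using (DecidableEquality)
open import Relation.Binary.PropositionalEquality.Core using (_≡_; _≢_)
open import Relation.Nullary.Decidable using (does)

------------------------------------------------------------------------
-- Asymptotics

IsΘ : (ℕ → ℕ) → (ℕ → ℕ) → Set
IsΘ f g = ∃ λ c → ∃ λ N → ∀ n → N ≤ n → (f n ≤ c * g n) × (g n ≤ c * f n)

-- r n / n → 0.
IsLittleO-n : (ℕ → ℕ) → Set
IsLittleO-n r = ∀ c → ∃ λ N → ∀ n → N ≤ n → c * r n ≤ n

-- The word size is Θ(lg n).  As the Θ permits constants below 1, it is also
-- required that every number up to 2n (the largest value of k, and the number
-- of entries of a 2 × n array) is a word.
WordSize : (ℕ → ℕ) → Set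
WordSize w = IsΘ w ⌊log₂_⌋ × (∀ n → 2 * n < 2 ^ w n)

------------------------------------------------------------------------
-- Bit strings and words

BitString : Set
BitString = List Bool

-- Least significant bit first.
fromBits : BitString → ℕ
fromBits []           = 0
fromBits (true  ∷ bs) = 1 + 2 * fromBits bs
fromBits (false ∷ bs) = 2 * fromBits bs

toBits : ℕ → ℕ → BitString
toBits zero    a = []
toBits (suc w) a = (a % 2 ≡ᵇ 1) ∷ toBits w (a / 2)

Word : ℕ → Set
Word w = Fin (2 ^ w)

word : ∀ w → ℕ → Word w
word w a = _mod_ a (2 ^ w) {{m^n≢0 2 w}}

------------------------------------------------------------------------
-- The word RAM, as a structured language
--
-- A program uses finitely many registers, a read-only memory that holds the
-- encoding, a working memory, and a write-only memory for the answer.  All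
-- cells are words and all memories are addressed by words.

data Op : Set where
  add sub mul div mod shl shr and or xor lt eq : Op

bitwise : (Bool → Bool → Bool) → ℕ → ℕ → ℕ → ℕ
bitwise f w a b = fromBits (zipWith f (toBits w a) (toBits w b))

-- Results are reduced modulo 2 ^ w; division by zero yields zero.
⟦_⟧ : Op → ℕ → ℕ → ℕ → ℕ
⟦ add ⟧ w a b       = a + b
⟦ sub ⟧ w a b       = a + (2 ^ w ∸ b)
⟦ mul ⟧ w a b       = a * b
⟦ div ⟧ w a zero    = 0
⟦ div ⟧ w a (suc b) = a / suc b
⟦ mod ⟧ w a zero    = 0
⟦ mod ⟧ w a (suc b) = a % suc b
⟦ shl ⟧ w a b       = a * 2 ^ b
⟦ shr ⟧ w a b       = _/_ a (2 ^ b) {{m^n≢0 2 b}}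
⟦ and ⟧ w a b       = bitwise _∧_ w a b
⟦ or  ⟧ w a b       = bitwise _∨_ w a b
⟦ xor ⟧ w a b       = bitwise _xor_ w a b
⟦ lt  ⟧ w a b       = if a <ᵇ b then 1 else 0
⟦ eq  ⟧ w a b       = if a ≡ᵇ b then 1 else 0

Reg : Set
Reg = ℕ

infixr 5 _⨾_

-- In `read r a`, `load r a`, `store a r` and `write a r` the register `a`
-- holds the address and `r` the value.
data Prog : Set where
  skip       : Prog
  _⨾_        : Prog → Prog → Prog
  const      : Reg → ℕ → Prog
  copy       : Reg → Reg → Prog
  op         : Reg → Op → Reg → Reg → Prog
  read       : Reg → Reg → Prog
  load       : Reg → Reg → Prog
  store      : Reg → Reg → Prog
  write      : Reg → Reg → Prog
  ifnz       : Reg → Prog → Prog → Prog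
  while      : Reg → Prog → Prog

Memory : ℕ → Set
Memory w = Word w → Word w

record State (w : ℕ) : Set where
  constructor state
  field
    reg : Reg → Word w
    ram : Memory w
    out : Memory w
open State public

update : ∀ {a b} {A : Set a} {B : Set b} → DecidableEquality A →
         (A → B) → A → B → A → B
update _≟_ f x y z = if does (z ≟ x) then y else f z

module _ {w : ℕ} where

  setReg : Reg → Word w → State w → State w
  setReg r v σ = record σ { reg = update _≟ℕ_ (reg σ) r v }

  setRam : Word w → Word w → State w → State w
  setRam a v σ = record σ { ram = update _≟F_ (ram σ) a v }

  setOut : Word w → Word w → State w → State w
  setOut a v σ = record σ { out = update _≟F_ (out σ) a v }

  -- rom ⊢ P , σ ⇓ σ′ [ t ] : with read-only memory rom, program P takes state
  -- σ to state σ′ in exactly t steps.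
  data _⊢_,_⇓_[_] (rom : Memory w) : Prog → State w → State w → ℕ → Set where
    ⇓skip  : ∀ {σ} → rom ⊢ skip , σ ⇓ σ [ 0 ]
    ⇓seq   : ∀ {P Q σ σ′ σ″ s t} →
             rom ⊢ P , σ ⇓ σ′ [ s ] → rom ⊢ Q , σ′ ⇓ σ″ [ t ] →
             rom ⊢ P ⨾ Q , σ ⇓ σ″ [ s + t ]
    ⇓const : ∀ {σ r c} →
             rom ⊢ const r c , σ ⇓ setReg r (word w c) σ [ 1 ]
    ⇓copy  : ∀ {σ r p} →
             rom ⊢ copy r p , σ ⇓ setReg r (reg σ p) σ [ 1 ]
    ⇓op    : ∀ {σ r o p q} →
             rom ⊢ op r o p q , σ
               ⇓ setReg r (word w (⟦ o ⟧ w (toℕ (reg σ p)) (toℕ (reg σ q)))) σ [ 1 ]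
    ⇓read  : ∀ {σ r a} →
             rom ⊢ read r a , σ ⇓ setReg r (rom (reg σ a)) σ [ 1 ]
    ⇓load  : ∀ {σ r a} →
             rom ⊢ load r a , σ ⇓ setReg r (ram σ (reg σ a)) σ [ 1 ]
    ⇓store : ∀ {σ a r} →
             rom ⊢ store a r , σ ⇓ setRam (reg σ a) (reg σ r) σ [ 1 ]
    ⇓write : ∀ {σ a r} →
             rom ⊢ write a r , σ ⇓ setOut (reg σ a) (reg σ r) σ [ 1 ]
    ⇓then  : ∀ {r P Q σ σ′ t} → toℕ (reg σ r) ≢ 0 →
             rom ⊢ P , σ ⇓ σ′ [ t ] →
             rom ⊢ ifnz r P Q , σ ⇓ σ′ [ 1 + t ]
    ⇓else  : ∀ {r P Q σ σ′ t} → toℕ (reg σ r) ≡ 0 →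
             rom ⊢ Q , σ ⇓ σ′ [ t ] →
             rom ⊢ ifnz r P Q , σ ⇓ σ′ [ 1 + t ]
    ⇓done  : ∀ {r P σ} → toℕ (reg σ r) ≡ 0 →
             rom ⊢ while r P , σ ⇓ σ [ 1 ]
    ⇓loop  : ∀ {r P σ σ′ σ″ s t} → toℕ (reg σ r) ≢ 0 →
             rom ⊢ P , σ ⇓ σ′ [ s ] → rom ⊢ while r P , σ′ ⇓ σ″ [ t ] →
             rom ⊢ while r P , σ ⇓ σ″ [ 1 + s + t ]

module _ (w : ℕ) where

  -- x is an address, and the cell at that address contains v.
  Cell : Memory w → ℕ → ℕ → Set
  Cell m x v = Σ (Word w) λ a → toℕ a ≡ x × toℕ (m a) ≡ v

  -- β occupies ⌈ length β / w ⌉ consecutive cells, the first at address e, the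
  -- last one padded with zeros.  All these cells exist, so in particular β
  -- fits into the address space.
  StoredAt : Memory w → ℕ → BitString → Set
  StoredAt m e β = ∀ i → i * w < length β →
                   Cell m (e + i) (fromBits (take w (drop (i * w) β)))

  Holds : Memory w → ℕ → List ℕ → Set
  Holds m o xs = ∀ (t : Fin (length xs)) → Cell m (o + toℕ t) (lookup xs t)

RegsHold : ∀ {w} → State w → List ℕ → Set
RegsHold σ xs = ∀ (i : Fin (length xs)) → toℕ (reg σ (toℕ i)) ≡ lookup xs i

-- Calling convention.  P is called with the arguments args, a pointer e to the
-- bit string β and a pointer o to the place for the answer, in registers
-- 0, 1, 2, …; there is room for `room` words from o on.  Whatever all remaining
-- cells and registers contain initially, P halts within t steps, leaves the
-- answer memory below o intact, and produces an answer satisfying Post.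
Computes : ∀ {ℓ} (w : ℕ) → Prog → BitString → (args : List ℕ) (room t : ℕ) →
           (Post : (o : ℕ) → State w → Set ℓ) → Set ℓ
Computes w P β args room t Post =
  ∀ (rom : Memory w) (σ : State w) (e o : ℕ) →
  StoredAt w rom e β → o + room ≤ 2 ^ w →
  RegsHold σ (args ++ e ∷ o ∷ []) →
  Σ (State w) λ σ′ → Σ ℕ λ s →
    (rom ⊢ P , σ ⇓ σ′ [ s ]) × (s ≤ t) ×
    (∀ a → toℕ a < o → out σ′ a ≡ out σ a) ×
    Post o σ′

-- Position i : Fin n stands for the 1-based index pos i.
pos : ∀ {n} → Fin n → ℕ
pos i = suc (toℕ i)

_∈[_‥_] : ∀ {n} → Fin n → ℕ → ℕ → Set
p ∈[ i ‥ j ] = i ≤ pos p × pos p ≤ j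

------------------------------------------------------------------------
-- Top-k queries and encodings for arrays over a totally ordered set

module _ {a ℓ₁ ℓ₂ : Level} (O : StrictTotalOrder a ℓ₁ ℓ₂) where

  open StrictTotalOrder O using () renaming (Carrier to V; _≈_ to _≈ⱽ_; _<_ to _<ⱽ_)

  DistinctEntries : {I : Set} → (I → V) → Set ℓ₁
  DistinctEntries B = Injective _≡_ _≈ⱽ_ B

  -- ps lists, in some order, the positions of the k largest values of B in the
  -- region R, or all positions of R if there are at most k of them.
  IsTopK : {I : Set} → ℕ → (I → Set) → (I → V) → List I → Set ℓ₂
  IsTopK k R B ps =
    Unique ps × All R ps ×
    (length ps ≤ k) × (length ps < k → ∀ q → R q → q ∈ ps) ×
    (∀ p q → p ∈ ps → R q → q ∉ ps → B q <ⱽ B p)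

  Decreasing : {I : Set} → (I → V) → List I → Set ℓ₂
  Decreasing B = AllPairs (λ p q → B q <ⱽ B p)

  TopK₁ : ∀ {n} → ℕ → (i j : ℕ) → (Fin n → V) → List (Fin n) → Set ℓ₂
  TopK₁ k i j = IsTopK k (λ p → p ∈[ i ‥ j ])

  TopK₂ : ∀ {m n} → ℕ → (i j a b : ℕ) → (Fin m × Fin n → V) →
          List (Fin m × Fin n) → Set ℓ₂
  TopK₂ k i j a b = IsTopK k (uncurry λ p q → p ∈[ i ‥ j ] × q ∈[ a ‥ b ])

  -- Every array of size n has an encoding of at most s bits from which P
  -- answers every sorted 1-sided Top-k query in time t.
  Sorted1SidedEncoding : (w : ℕ) → Prog → (n k s t : ℕ) → Set (a ⊔ ℓ₁ ⊔ ℓ₂)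
  Sorted1SidedEncoding w P n k s t =
    (B : Fin n → V) → DistinctEntries B →
    Σ BitString λ β → length β ≤ s ×
      (∀ j → 1 ≤ j → j ≤ n →
       Computes w P β (n ∷ k ∷ j ∷ []) n t λ o σ′ →
         Σ (List (Fin n)) λ ps →
           TopK₁ k 1 j B ps × Decreasing B ps ×
           Holds w (out σ′) o (map pos ps))

  -- Every 2 × n array has an encoding of at most s bits from which P answers
  -- every unsorted 3-sided Top-k query in time t.  Positions are reported row
  -- by row: the columns of the reported positions of row 1 and then those of
  -- row 2, with the numbers of positions from the two rows in registers 0
  -- and 1.
  Unsorted3SidedEncoding : (w : ℕ) → Prog → (n k s t : ℕ) → Set (a ⊔ ℓ₁ ⊔ ℓ₂)
  Unsorted3SidedEncoding w P n k s t =
    (A : Fin 2 × Fin n → V) → DistinctEntries A →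
    Σ BitString λ β → length β ≤ s ×
      (∀ i j b → 1 ≤ i → i ≤ j → j ≤ 2 → 1 ≤ b → b ≤ n →
       Computes w P β (n ∷ k ∷ i ∷ j ∷ b ∷ []) (2 * n) t λ o σ′ →
         Σ (List (Fin n)) λ cs → Σ (List (Fin n)) λ ds →
           TopK₂ k i j 1 b A (map (zero ,_) cs ++ map (suc zero ,_) ds) ×
           RegsHold σ′ (length cs ∷ length ds ∷ []) ×
           Holds w (out σ′) o (map pos (cs ++ ds)))

module Submission where

-- In a query on both rows, let K b be the number of positions from row 1 among
-- the top k of the first b columns.  The top k then are the first K b entries
-- of the sorted Top-k answer for row 1 and the first (k ⊓ 2b) ∸ K b entries of
-- that for row 2.  One more column contributes at most one position per row, so
-- that K b changes by at most 1; and K b = b as long as 2b ≤ k.  Hence K is a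
-- prefix sum over n - ⌊k/2⌋ trits.  As many trits as possible are packed into a
-- word, together with the sum of the trits of the preceding words of a group of
-- slowly growing length; the sum before each group takes a further word.  The
-- trits within a word are summed up in O(1) pieces, by table lookup.

open import Defs
open import Data.Bool.Base as Bool using (true; false)
open import Data.Fin.Base using (Fin; zero; suc; toℕ; fromℕ<)
open import Data.Fin.Properties using (_≟_; toℕ<n; toℕ-fromℕ<; toℕ-injective)
open import Data.List.Base using
    (List; []; _∷_; _++_; length; lookup; map; take; drop; concatMap; applyUpTo)
open import Data.List.Membership.Propositional using (_∈_; _∉_)
open import Data.List.Membership.Propositional.Properties using
    (∈-++⁺ˡ; ∈-++⁺ʳ; ∈-++⁻; ∈-map⁺; ∈-map⁻)
open import Data.List.Properties
  using (length-++; length-map; length-take; length-applyUpTo; map-++; take-map; take-take; take-[];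
      take-all; take++drop≡id; ++-identityʳ)
open import Data.List.Relation.Binary.Pointwise as Pointwise using (Pointwise; []; _∷_)
open import Data.List.Relation.Unary.All as All using (All; []; _∷_)
import Data.List.Relation.Unary.All.Properties as All
open import Data.List.Relation.Unary.AllPairs as AllPairs using (AllPairs; []; _∷_)
open import Data.List.Relation.Unary.Any using (here; there)
open import Data.List.Relation.Unary.Unique.Propositional using (Unique)
import Data.List.Relation.Unary.Unique.Propositional.Properties as Unique
open import Data.Nat.Base hiding (compare)
open import Data.Nat.DivMod hiding (_div_; _mod_)
open import Data.Nat.Divisibility using (m∣m*n)
open import Data.Nat.Induction using (<-rec)
open import Data.Nat.ListAction using (sum)
open import Data.Nat.Logarithm
open import Data.Nat.Properties renaming (_≟_ to _≟ℕ_)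
open import Data.Nat.Tactic.RingSolver using (solve-∀)
open import Data.Product.Base using (Σ; ∃; _×_; _,_; proj₁; proj₂)
open import Data.Sum.Base using (_⊎_; inj₁; inj₂; [_,_]′)
open import Data.Unit.Base using (⊤; tt)
open import Function.Base using (_∘_)
open import Relation.Binary.Bundles using (StrictTotalOrder)
open import Relation.Binary.Definitions using (tri<; tri≈; tri>)
open import Relation.Binary.PropositionalEquality
open import Relation.Nullary.Decidable using (yes; no; True; toWitness; dec-true; dec-false)
open import Relation.Nullary.Negation using (¬_; contradiction)

open import Algebra.Properties.CommutativeSemigroup +-commutativeSemigroup using (x∙yz≈y∙xz)

-- The obstacle is the leading constant: beyond lg 3 bits per trit, only o(n) bits may be spent. A
-- full prefix sum beside every word of trits would cost a constant fraction of the space. Within a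
-- group of about w words, however, a sum has only O(lg w) trits, so it fits into the word itself
-- and leaves all but a vanishing part of it to the trits; a full word per group then costs O(n / w)
-- bits. As a power of 3 only approximates the capacity of a word, up to one further trit per word
-- is lost. K may also fall, because a new entry of row 2 can push one of row 1 out of the top k;
-- hence trits and not bits. Row 2 needs no sequence of its own, because the total of both rows is
-- known. The machine works in base 2, so the powers of 3 and the digit sums of short pieces are
-- tabulated. The table remains small only if a piece has a small fraction of lg n trits, and the
-- number of pieces is then a constant that depends on the word size. The given program is a black
-- box: the query saves its data in registers that this program never writes, calls it once for each
-- row, and lets the second answer overwrite the surplus of the first.

-- How many of the reported positions are in row 1 and in row 2, where K of the
-- positions for a query on both rows are in row 1.
count₁ count₂ : (k i j b K : ℕ) → ℕ
count₁ k i j b K = ⟦ lt ⟧ 0 i 2 * (⟦ lt ⟧ 0 j 2 * (k ⊓ b) + ⟦ lt ⟧ 0 1 j * K)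
count₂ k i j b K = (k ⊓ ((j ∸ i) * b + b)) ∸ count₁ k i j b K

lt*-≤ : ∀ a b x → ⟦ lt ⟧ 0 a b * x ≤ x
lt*-≤ a b x with a <ᵇ b
... | true  = ≤-reflexive (*-identityˡ x)
... | false = z≤n

-- Exactly one of the two comparisons yields 1, so the sum selects one of the terms. Branch-free
-- selection lets the counts be compiled as expressions, and this bound keeps them from overflowing.
oneOf-≤ : ∀ j {x y b} → x ≤ b → y ≤ b → ⟦ lt ⟧ 0 j 2 * x + ⟦ lt ⟧ 0 1 j * y ≤ b
oneOf-≤ 0             {x} x≤b _   =
    ≤-trans (≤-reflexive (trans (+-identityʳ _) (*-identityˡ x))) x≤b
oneOf-≤ 1             {x} x≤b _   =
    ≤-trans (≤-reflexive (trans (+-identityʳ _) (*-identityˡ x))) x≤b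
oneOf-≤ (suc (suc j)) {y = y} _   y≤b = ≤-trans (≤-reflexive (*-identityˡ y)) y≤b

count₁-≤ : ∀ k i j {b K} → K ≤ b → count₁ k i j b K ≤ b
count₁-≤ k i j {b} K≤b = ≤-trans (lt*-≤ i 2 _) (oneOf-≤ j (m⊓n≤n k b) K≤b)

data Rows : ℕ → ℕ → Set where
  first  : Rows 1 1
  second : Rows 2 2
  both   : Rows 1 2

rows : ∀ {i j} → 1 ≤ i → i ≤ j → j ≤ 2 → Rows i j
rows (s≤s z≤n) (s≤s z≤n)       (s≤s z≤n)       = first
rows (s≤s z≤n) (s≤s z≤n)       (s≤s (s≤s z≤n)) = both
rows (s≤s z≤n) (s≤s (s≤s z≤n)) (s≤s (s≤s z≤n)) = second

-- Lists of positions: prefixes and restriction to a row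

∈-take⊎drop : ∀ {a} {A : Set a} k (xs : List A) {x} → x ∈ xs → x ∈ take k xs ⊎ x ∈ drop k xs
∈-take⊎drop k xs x∈ = ∈-++⁻ (take k xs) (subst (_ ∈_) (sym (take++drop≡id k xs)) x∈)

AllPairs-take-drop : ∀ {a r} {A : Set a} {R : A → A → Set r} k {xs x y} →
                     AllPairs R xs → x ∈ take k xs → y ∈ drop k xs → R x y
AllPairs-take-drop (suc k) (all ∷ _)   (here refl) y∈ =
  All.lookup all (drop⊆ k y∈)
  where
  drop⊆ : ∀ {a} {A : Set a} k {xs : List A} {x} → x ∈ drop k xs → x ∈ xs
  drop⊆ k {xs} x∈ = subst (_ ∈_) (take++drop≡id k xs) (∈-++⁺ʳ (take k xs) x∈)
AllPairs-take-drop (suc k) (_ ∷ pairs) (there x∈)  y∈ = AllPairs-take-drop k pairs x∈ y∈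

AllPairs-take : ∀ {a r} {A : Set a} {R : A → A → Set r} k {xs} → AllPairs R xs →
    AllPairs R (take k xs)
AllPairs-take zero    _           = []
AllPairs-take (suc k) []          = []
AllPairs-take (suc k) (all ∷ aps) = All.take⁺ k all ∷ AllPairs-take k aps

module _ {n : ℕ} where

  row : Fin 2 → List (Fin 2 × Fin n) → List (Fin n)
  row r []            = []
  row r ((s , q) ∷ l) with r ≟ s
  ... | yes _ = q ∷ row r l
  ... | no  _ = row r l

  rowSize : Fin 2 → List (Fin 2 × Fin n) → ℕ
  rowSize r l = length (row r l)

  rowSize-sum : ∀ l → rowSize zero l + rowSize (suc zero) l ≡ length l
  rowSize-sum []                    = refl
  rowSize-sum ((zero , _) ∷ l)      = cong suc (rowSize-sum l)
  rowSize-sum ((suc zero , _) ∷ l)  = trans (+-suc _ _) (cong suc (rowSize-sum l))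

  ∈-row⁺ : ∀ {r q l} → (r , q) ∈ l → q ∈ row r l
  ∈-row⁺ {r} (here refl) with r ≟ r
  ... | yes _   = here refl
  ... | no  r≢r = contradiction refl r≢r
  ∈-row⁺ {r} {l = (s , _) ∷ _} (there q∈) with r ≟ s
  ... | yes _ = there (∈-row⁺ q∈)
  ... | no  _ = ∈-row⁺ q∈

  ∈-row⁻ : ∀ {r q} l → q ∈ row r l → (r , q) ∈ l
  ∈-row⁻ {r} ((s , _) ∷ l) q∈ with r ≟ s | q∈
  ... | yes refl | here refl = here refl
  ... | yes refl | there q∈′ = there (∈-row⁻ l q∈′)
  ... | no  _    | q∈′       = there (∈-row⁻ l q∈′)

  AllPairs-row : ∀ {ℓ} {R : Fin 2 × Fin n → Fin 2 × Fin n → Set ℓ} r {l} →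
                 AllPairs R l → AllPairs (λ p q → R (r , p) (r , q)) (row r l)
  AllPairs-row r []                              = []
  AllPairs-row r {(s , _) ∷ l} (all ∷ pairs) with r ≟ s
  ... | yes refl = All.tabulate (All.lookup all ∘ ∈-row⁻ l) ∷ AllPairs-row r pairs
  ... | no  _    = AllPairs-row r pairs

  -- Restriction to a row keeps the order, so a prefix of the list meets the row in a prefix of the
  -- restricted list. Hence a single number describes the share of a row in an answer.
  row-take : ∀ r k l → row r (take k l) ≡ take (rowSize r (take k l)) (row r l)
  row-take r zero    l             = refl
  row-take r (suc k) []            = refl
  row-take r (suc k) ((s , q) ∷ l) with r ≟ s
  ... | yes _ = cong (q ∷_) (row-take r k l)
  ... | no  _ = row-take r k l

  rowSize-∷ : ∀ r p l → rowSize r (p ∷ l) ≡ rowSize r (p ∷ []) + rowSize r l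
  rowSize-∷ r (s , _) l with r ≟ s
  ... | yes _ = refl
  ... | no  _ = refl

  rowSize-take-≤ : ∀ r k l → rowSize r (take k l) ≤ rowSize r (take (suc k) l)
  rowSize-take-≤ r zero    l             = z≤n
  rowSize-take-≤ r (suc k) []            = z≤n
  rowSize-take-≤ r (suc k) ((s , q) ∷ l) with r ≟ s
  ... | yes _ = s≤s (rowSize-take-≤ r k l)
  ... | no  _ = rowSize-take-≤ r k l

-- Top-k answers as prefixes of decreasing lists

module _ {a ℓ₁ ℓ₂} (O : StrictTotalOrder a ℓ₁ ℓ₂) where

  open StrictTotalOrder O using (module Eq; compare)
    renaming (Carrier to V; _≈_ to _≈ⱽ_; _<_ to _<ⱽ_; _<?_ to _<ⱽ?_; trans to <ⱽ-trans;
              irrefl to <ⱽ-irrefl; asym to <ⱽ-asym)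

  Decreasing⇒Unique : ∀ {I : Set} {B : I → V} {ps} → Decreasing O B ps → Unique ps
  Decreasing⇒Unique = AllPairs.map λ { q<p refl → <ⱽ-irrefl Eq.refl q<p }

  take-IsTopK : ∀ {I : Set} {R : I → Set} {B : I → V} {l} k → Decreasing O B l → All R l →
                (∀ q → R q → q ∈ l) → IsTopK O k R B (take k l)
  take-IsTopK {l = l} k dec inR complete =
      Decreasing⇒Unique (AllPairs-take k dec)
    , All.take⁺ k inR
    , ≤-trans (≤-reflexive (length-take k l)) (m⊓n≤m k _)
    , (λ short q Rq → subst (q ∈_) (sym (take-all k l (fits short))) (complete q Rq))
    , λ p q p∈ Rq q∉ → [ (λ q∈ → contradiction q∈ q∉) , AllPairs-take-drop k dec p∈ ]′
                         (∈-take⊎drop k l (complete q Rq))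
    where
    fits : length (take k l) < k → length l ≤ k
    fits short with ≤-total k (length l)
    ... | inj₂ l≤k = l≤k
    ... | inj₁ k≤l = contradiction
      (subst (_< k) (trans (length-take k l) (m≤n⇒m⊓n≡m k≤l)) short) (n≮n k)

  IsTopK-respˡ : ∀ {I : Set} {R : I → Set} {B : I → V} {k ps qs} → Unique qs →
                 length qs ≡ length ps → (∀ {p} → p ∈ qs → p ∈ ps) → (∀ {p} → p ∈ ps → p ∈ qs) →
                 IsTopK O k R B ps → IsTopK O k R B qs
  IsTopK-respˡ unique len qs⊆ps ps⊆qs (_ , inR , ≤k , complete , top) =
      unique
    , All.tabulate (All.lookup inR ∘ qs⊆ps)
    , subst (_≤ _) (sym len) ≤k
    , (λ short q Rq → ps⊆qs (complete (subst (_< _) len short) q Rq))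
    , λ p q p∈ Rq q∉ → top p q (qs⊆ps p∈) Rq (q∉ ∘ ps⊆qs)

  -- If the head of `xs` were further down in `ys`, the head of `ys` would exceed it and thus lie
  -- outside the decreasing list `x ∷ xs`, contradicting the last hypothesis. So the heads agree,
  -- and induction applies to the tails. This pins down the list returned by the given program, of
  -- which only the specification is known.
  sortedTop-unique : ∀ {I : Set} {B : I → V} k xs ys → Decreasing O B xs → Decreasing O B ys →
                     length xs ≤ k → (∀ {p} → p ∈ xs → p ∈ ys) →
                     (length xs < k → ∀ {p} → p ∈ ys → p ∈ xs) →
                     (∀ {p q} → p ∈ xs → q ∈ ys → q ∉ xs → B q <ⱽ B p) →
                     xs ≡ take k ys
  sortedTop-unique zero    []       ys       _ _ _ _ _ _ = refl
  sortedTop-unique (suc k) []       []       _ _ _ _ _ _ = refl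
  sortedTop-unique (suc k) []       (y ∷ ys) _ _ _ _ ys⊆ _ with () ← ys⊆ (s≤s z≤n) (here refl)
  sortedTop-unique (suc k) (x ∷ xs) []       _ _ _ xs⊆ _ _ with () ← xs⊆ (here refl)
  sortedTop-unique {B = B} (suc k) (x ∷ xs) (y ∷ ys) (x> ∷ dxs) (y> ∷ dys) (s≤s ≤k) xs⊆ ys⊆ top =
    cong₂ _∷_ x≡y (sortedTop-unique k xs ys dxs dys ≤k xs⊆′ ys⊆′ top′)
    where
    y∉xs : B x <ⱽ B y → y ∉ x ∷ xs
    y∉xs x<y (here refl) = <ⱽ-irrefl Eq.refl x<y
    y∉xs x<y (there y∈)  = <ⱽ-asym x<y (All.lookup x> y∈)

    x≡y : x ≡ y
    x≡y with xs⊆ (here refl)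
    ... | here x≡y = x≡y
    ... | there x∈ = contradiction (top (here refl) (here refl) (y∉xs x<y)) (<ⱽ-asym x<y)
      where x<y = All.lookup y> x∈

    xs⊆′ : ∀ {p} → p ∈ xs → p ∈ ys
    xs⊆′ p∈ with xs⊆ (there p∈)
    ... | there p∈′ = p∈′
    ... | here refl = contradiction (subst (λ i → B i <ⱽ B x) (sym x≡y) (All.lookup x> p∈))
        (<ⱽ-irrefl Eq.refl)

    x∉ys : ∀ {p} → p ∈ ys → p ≢ x
    x∉ys p∈ refl = <ⱽ-irrefl Eq.refl (subst (λ i → B x <ⱽ B i) (sym x≡y) (All.lookup y> p∈))

    ys⊆′ : length xs < k → ∀ {p} → p ∈ ys → p ∈ xs
    ys⊆′ short p∈ with ys⊆ (s≤s short) (there p∈)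
    ... | there p∈′ = p∈′
    ... | here p≡x  = contradiction p≡x (x∉ys p∈)

    top′ : ∀ {p q} → p ∈ xs → q ∈ ys → q ∉ xs → B q <ⱽ B p
    top′ p∈ q∈ q∉ = top (there p∈) (there q∈) λ where
      (here q≡x)  → x∉ys q∈ q≡x
      (there q∈′) → q∉ q∈′

  module _ {I : Set} (A : I → V) where

    insert : I → List I → List I
    insert x []       = x ∷ []
    insert x (y ∷ ys) with A y <ⱽ? A x
    ... | yes _ = x ∷ y ∷ ys
    ... | no  _ = y ∷ insert x ys

    ∈-insert⁻ : ∀ {x z} ys → z ∈ insert x ys → z ∈ x ∷ ys
    ∈-insert⁻ []       z∈ = z∈
    ∈-insert⁻ {x} (y ∷ ys) z∈ with A y <ⱽ? A x | z∈
    ... | yes _ | z∈′       = z∈′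
    ... | no  _ | here z≡y  = there (here z≡y)
    ... | no  _ | there z∈′ with ∈-insert⁻ ys z∈′
    ...   | here z≡x  = here z≡x
    ...   | there z∈″ = there (there z∈″)

    ∈-insert⁺ : ∀ {x z} ys → z ∈ x ∷ ys → z ∈ insert x ys
    ∈-insert⁺ []       z∈ = z∈
    ∈-insert⁺ {x} (y ∷ ys) z∈ with A y <ⱽ? A x | z∈
    ... | yes _ | z∈′               = z∈′
    ... | no  _ | here z≡x          = there (∈-insert⁺ ys (here z≡x))
    ... | no  _ | there (here z≡y)  = here z≡y
    ... | no  _ | there (there z∈′) = there (∈-insert⁺ ys (there z∈′))

    insert-decreasing : ∀ {x ys} → (∀ {y} → y ∈ ys → ¬ A x ≈ⱽ A y) →
                        Decreasing O A ys → Decreasing O A (insert x ys)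
    insert-decreasing {x} {[]}     x≉ []          = [] ∷ []
    insert-decreasing {x} {y ∷ ys} x≉ (y> ∷ dys) with A y <ⱽ? A x
    ... | yes y<x = (y<x ∷ All.map (λ z<y → <ⱽ-trans z<y y<x) y>) ∷ y> ∷ dys
    ... | no  y≮x = All.tabulate (below ∘ ∈-insert⁻ ys) ∷ insert-decreasing (x≉ ∘ there) dys
      where
      below : ∀ {z} → z ∈ x ∷ ys → A z <ⱽ A y
      below (there z∈) = All.lookup y> z∈
      below (here refl) with compare (A x) (A y)
      ... | tri< x<y _ _ = x<y
      ... | tri≈ _ x≈y _ = contradiction x≈y (x≉ (here refl))
      ... | tri> _ _ y<x = contradiction y<x y≮x

  -- How the top k of the first b columns split between the rows

  module _ {n : ℕ} (A : Fin 2 × Fin n → V) where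

    rowSize-insert : ∀ r x l → rowSize r (insert A x l) ≡ rowSize r (x ∷ l)
    rowSize-insert r x []      = refl
    rowSize-insert r x (y ∷ l) with A y <ⱽ? A x
    ... | yes _ = refl
    ... | no  _ = begin
      rowSize r (y ∷ insert A x l)                               ≡⟨ rowSize-∷ r y _ ⟩
      rowSize r (y ∷ []) + rowSize r (insert A x l)
        ≡⟨ cong (rowSize r (y ∷ []) +_) (rowSize-insert r x l) ⟩
      rowSize r (y ∷ []) + rowSize r (x ∷ l)
        ≡⟨ cong (rowSize r (y ∷ []) +_) (rowSize-∷ r x l) ⟩
      rowSize r (y ∷ []) + (rowSize r (x ∷ []) + rowSize r l)
        ≡⟨ x∙yz≈y∙xz (rowSize r (y ∷ [])) (rowSize r (x ∷ [])) _ ⟩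
      rowSize r (x ∷ []) + (rowSize r (y ∷ []) + rowSize r l)
        ≡⟨ cong (rowSize r (x ∷ []) +_) (rowSize-∷ r y l) ⟨
      rowSize r (x ∷ []) + rowSize r (y ∷ l)                     ≡⟨ rowSize-∷ r x _ ⟨
      rowSize r (x ∷ y ∷ l)                                      ∎
      where open ≡-Reasoning

    -- The first k entries after the insertion are `x` or were among the first k before it: apart
    -- from adding `x`, an insertion can only push entries out.
    rowSize-take-insert : ∀ r k x l → rowSize r (take k (insert A x l)) ≤ rowSize r (x ∷ [])
        + rowSize r (take k l)
    rowSize-take-insert r zero    x l       = z≤n
    rowSize-take-insert r (suc k) x []      rewrite take-[] {A = Fin 2 × Fin n} k = m≤m+n _ 0
    rowSize-take-insert r (suc k) x (y ∷ l) with A y <ⱽ? A x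
    ... | yes _ = begin
      rowSize r (x ∷ take k (y ∷ l))                           ≡⟨ rowSize-∷ r x _ ⟩
      rowSize r (x ∷ []) + rowSize r (take k (y ∷ l))
        ≤⟨ +-monoʳ-≤ (rowSize r (x ∷ [])) (rowSize-take-≤ r k (y ∷ l)) ⟩
      rowSize r (x ∷ []) + rowSize r (take (suc k) (y ∷ l))    ∎
      where open ≤-Reasoning
    ... | no  _ = begin
      rowSize r (y ∷ take k (insert A x l))                             ≡⟨ rowSize-∷ r y _ ⟩
      rowSize r (y ∷ []) + rowSize r (take k (insert A x l))
        ≤⟨ +-monoʳ-≤ (rowSize r (y ∷ [])) (rowSize-take-insert r k x l) ⟩
      rowSize r (y ∷ []) + (rowSize r (x ∷ []) + rowSize r (take k l))
        ≡⟨ x∙yz≈y∙xz (rowSize r (y ∷ [])) (rowSize r (x ∷ [])) _ ⟩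
      rowSize r (x ∷ []) + (rowSize r (y ∷ []) + rowSize r (take k l))
        ≡⟨ cong (rowSize r (x ∷ []) +_) (rowSize-∷ r y _) ⟨
      rowSize r (x ∷ []) + rowSize r (take (suc k) (y ∷ l))             ∎
      where open ≤-Reasoning

    -- Built by insertion, so that one more column amounts to two insertions whose effect on the
    -- counts can be traced. Constant from `n` on, so that the counts change by at most 1 at all
    -- indices, also for trits of the last word that lie beyond the array.
    columns : ℕ → List (Fin 2 × Fin n)
    columns zero    = []
    columns (suc b) with b <? n
    ... | yes b<n = insert A (zero , fromℕ< b<n) (insert A (suc zero , fromℕ< b<n) (columns b))
    ... | no  _   = columns b

    columns⁻ : ∀ b {r q} → (r , q) ∈ columns b → toℕ q < b
    columns⁻ (suc b) p∈ with b <? n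
    ... | no  _   = m<n⇒m<1+n (columns⁻ b p∈)
    ... | yes b<n with ∈-insert⁻ A (insert A _ (columns b)) p∈
    ...   | here refl = s≤s (≤-reflexive (toℕ-fromℕ< b<n))
    ...   | there p∈′ with ∈-insert⁻ A (columns b) p∈′
    ...     | here refl = s≤s (≤-reflexive (toℕ-fromℕ< b<n))
    ...     | there p∈″ = m<n⇒m<1+n (columns⁻ b p∈″)

    columns⁺ : ∀ b r q → toℕ q < b → (r , q) ∈ columns b
    columns⁺ (suc b) r q (s≤s q≤b) with b <? n | m≤n⇒m<n∨m≡n q≤b
    ... | no  b≮n | inj₁ q<b = columns⁺ b r q q<b
    ... | no  b≮n | inj₂ q≡b = contradiction (subst (_< n) q≡b (toℕ<n q)) b≮n
    ... | yes b<n | inj₁ q<b =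
      ∈-insert⁺ A (insert A _ (columns b))
          (there (∈-insert⁺ A (columns b) (there (columns⁺ b r q q<b))))
    ... | yes b<n | inj₂ q≡b with toℕ-injective {i = q} (trans q≡b (sym (toℕ-fromℕ< b<n)))
    columns⁺ (suc b) zero q (s≤s q≤b) | yes b<n | inj₂ q≡b | refl =
      ∈-insert⁺ A (insert A _ (columns b)) (here refl)
    columns⁺ (suc b) (suc zero) q (s≤s q≤b) | yes b<n | inj₂ q≡b | refl =
      ∈-insert⁺ A (insert A _ (columns b)) (there (∈-insert⁺ A (columns b) (here refl)))

    rowSize-columns : ∀ r {b} → b ≤ n → rowSize r (columns b) ≡ b
    rowSize-columns r {zero}  _   = refl
    rowSize-columns r {suc b} b<n with b <? n
    ... | no  b≮n = contradiction b<n b≮n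
    ... | yes _   = trans (rowSize-insert r _ (insert A _ (columns b)))
                   (trans (rowSize-∷ r _ (insert A _ (columns b)))
                   (trans (cong (rowSize r (_ ∷ []) +_) (trans (rowSize-insert r _ (columns b))
                       (rowSize-∷ r _ (columns b))))
                          (one r)))
      where
      one : ∀ s {p q} → rowSize s ((zero , p) ∷ []) + (rowSize s ((suc zero , q) ∷ [])
          + rowSize r (columns b)) ≡ suc b
      one zero       = cong suc (rowSize-columns r (<⇒≤ b<n))
      one (suc zero) = cong suc (rowSize-columns r (<⇒≤ b<n))

    length-columns : ∀ {b} → b ≤ n → length (columns b) ≡ b + b
    length-columns {b} b≤n = trans (sym (rowSize-sum (columns b)))
                                   (cong₂ _+_ (rowSize-columns zero b≤n)
                                       (rowSize-columns (suc zero) b≤n))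

    topCount : ℕ → Fin 2 → ℕ → ℕ
    topCount k r b = rowSize r (take k (columns b))

    -- Of the two entries inserted, only one is in row `r`.
    topCount-suc : ∀ k r b → topCount k r (suc b) ≤ suc (topCount k r b)
    topCount-suc k r b with b <? n
    ... | no  _ = n≤1+n _
    ... | yes _ = ≤-trans (rowSize-take-insert r k _ (insert A _ (columns b)))
                 (≤-trans (+-monoʳ-≤ (rowSize r (_ ∷ [])) (rowSize-take-insert r k _ (columns b)))
                          (one r))
      where
      one : ∀ s {p q} → rowSize s ((zero , p) ∷ []) + (rowSize s ((suc zero , q) ∷ [])
          + topCount k r b) ≤ suc (topCount k r b)
      one zero       = ≤-refl
      one (suc zero) = ≤-refl

    topCount-sum : ∀ k {b} → b ≤ n → topCount k zero b + topCount k (suc zero) b ≡ k ⊓ (b + b)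
    topCount-sum k {b} b≤n = trans (rowSize-sum (take k (columns b)))
                            (trans (length-take k (columns b)) (cong (k ⊓_) (length-columns b≤n)))

    topCount-≤ : ∀ k r b → topCount k r b ≤ b
    topCount-≤ k r zero    rewrite take-[] {A = Fin 2 × Fin n} k = z≤n
    topCount-≤ k r (suc b) = ≤-trans (topCount-suc k r b) (s≤s (topCount-≤ k r b))

    -- One more column adds at most one position of row 2, and does not lower
    -- the number of positions reported in total.
    topCount-pred : ∀ k b → topCount k zero b ≤ suc (topCount k zero (suc b))
    topCount-pred k b with <-≤-connex b n
    ... | inj₁ b<n = +-cancelʳ-≤ (topCount k (suc zero) b) _ _ (begin
      topCount k zero b + topCount k (suc zero) b                   ≡⟨ topCount-sum k (<⇒≤ b<n) ⟩
      k ⊓ (b + b)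
        ≤⟨ ⊓-monoʳ-≤ k (+-mono-≤ (n≤1+n b) (n≤1+n b)) ⟩
      k ⊓ (suc b + suc b)                                           ≡⟨ topCount-sum k b<n ⟨
      topCount k zero (suc b) + topCount k (suc zero) (suc b)
        ≤⟨ +-monoʳ-≤ (topCount k zero (suc b)) (topCount-suc k (suc zero) b) ⟩
      topCount k zero (suc b) + suc (topCount k (suc zero) b)
        ≡⟨ +-suc (topCount k zero (suc b)) _ ⟩
      suc (topCount k zero (suc b) + topCount k (suc zero) b)       ∎)
      where open ≤-Reasoning
    ... | inj₂ n≤b with b <? n
    ...   | yes b<n = contradiction b<n (≤⇒≯ n≤b)
    ...   | no  _   = n≤1+n _

    -- Neither row can contribute more than b positions, yet together they contribute all 2b.
    topCount-all : ∀ k {b} → b ≤ n → b + b ≤ k → topCount k zero b ≡ b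
    topCount-all k {b} b≤n 2b≤k = ≤-antisym (topCount-≤ k zero b) (+-cancelʳ-≤ b _ _ (begin
      b + b                                        ≡⟨ m≥n⇒m⊓n≡n 2b≤k ⟨
      k ⊓ (b + b)                                  ≡⟨ topCount-sum k b≤n ⟨
      topCount k zero b + topCount k (suc zero) b
        ≤⟨ +-monoʳ-≤ (topCount k zero b) (topCount-≤ k (suc zero) b) ⟩
      topCount k zero b + b                        ∎))
      where open ≤-Reasoning

    module _ (distinct : DistinctEntries O A) where

      columns-decreasing : ∀ b → Decreasing O A (columns b)
      columns-decreasing zero    = []
      columns-decreasing (suc b) with b <? n
      ... | no  _   = columns-decreasing b
      ... | yes b<n = insert-decreasing A fresh₀ (insert-decreasing A fresh₁ (columns-decreasing b))
        where
        old : ∀ {s} → ¬ (s , fromℕ< b<n) ∈ columns b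
        old p∈ = <-irrefl (toℕ-fromℕ< b<n) (columns⁻ b p∈)

        fresh₁ : ∀ {p} → p ∈ columns b → ¬ A (suc zero , fromℕ< b<n) ≈ⱽ A p
        fresh₁ p∈ ≈p with refl ← distinct ≈p = old p∈

        fresh₀ : ∀ {p} → p ∈ insert A (suc zero , fromℕ< b<n) (columns b) →
            ¬ A (zero , fromℕ< b<n) ≈ⱽ A p
        fresh₀ p∈ ≈p with ∈-insert⁻ A (columns b) p∈ | distinct ≈p
        ... | there p∈′ | refl = old p∈′

      sortedTop : ∀ k r b {ps} → TopK₁ O k 1 b (A ∘ (r ,_)) ps → Decreasing O (A ∘ (r ,_)) ps →
                  ps ≡ take k (row r (columns b))
      sortedTop k r b {ps} (_ , inR , ≤k , complete , top) dec =
        sortedTop-unique k ps (row r (columns b)) dec (AllPairs-row r (columns-decreasing b)) ≤k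
          (λ p∈ → ∈-row⁺ (columns⁺ b r _ (proj₂ (All.lookup inR p∈))))
          (λ short p∈ → complete short _ (region p∈))
          (λ p∈ q∈ q∉ → top _ _ p∈ (region q∈) q∉)
        where
        region : ∀ {p} → p ∈ row r (columns b) → p ∈[ 1 ‥ b ]
        region p∈ = s≤s z≤n , columns⁻ b (∈-row⁻ (columns b) p∈)

      length-sortedTop : ∀ k r {b ps} → b ≤ n → TopK₁ O k 1 b (A ∘ (r ,_)) ps →
                         Decreasing O (A ∘ (r ,_)) ps → length ps ≡ k ⊓ b
      length-sortedTop k r {b} b≤n top dec =
        trans (cong length (sortedTop k r b top dec))
        (trans (length-take k _) (cong (k ⊓_) (rowSize-columns r b≤n)))

      -- The share of the row in the top k is a prefix of the row in decreasing order. As it has at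
      -- most k entries, it is also a prefix of the top k of that row alone.
      topOfRow : ∀ k r b {ps} → TopK₁ O k 1 b (A ∘ (r ,_)) ps → Decreasing O (A ∘ (r ,_)) ps →
                 take (topCount k r b) ps ≡ row r (take k (columns b))
      topOfRow k r b {ps} top dec = begin
        take (topCount k r b) ps
          ≡⟨ cong (take _) (sortedTop k r b top dec) ⟩
        take (topCount k r b) (take k (row r (columns b)))  ≡⟨ take-take (topCount k r b) k _ ⟩
        take (topCount k r b ⊓ k) (row r (columns b))
          ≡⟨ cong (λ i → take i (row r (columns b))) (m≤n⇒m⊓n≡m count≤k) ⟩
        take (topCount k r b) (row r (columns b))           ≡⟨ row-take r k (columns b) ⟨
        row r (take k (columns b))                          ∎
        where
        open ≡-Reasoning

        rowSize-≤ : ∀ s l → rowSize {n} s l ≤ length l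
        rowSize-≤ zero       l = subst (rowSize zero l ≤_) (rowSize-sum l) (m≤m+n _ _)
        rowSize-≤ (suc zero) l = subst (rowSize (suc zero) l ≤_) (rowSize-sum l) (m≤n+m _ _)

        count≤k : topCount k r b ≤ k
        count≤k = ≤-trans (rowSize-≤ r (take k (columns b)))
                          (subst (_≤ k) (sym (length-take k (columns b))) (m⊓n≤m k _))

      bothRows : ∀ k b → TopK₂ O k 1 2 1 b A
                   (map (zero ,_) (row zero (take k (columns b))) ++ map (suc zero ,_)
                       (row (suc zero) (take k (columns b))))
      bothRows k b =
        IsTopK-respˡ
          (Unique.++⁺ (Unique.map⁺ (cong proj₂) (unique zero))
              (Unique.map⁺ (cong proj₂) (unique (suc zero))) disjoint)
          (trans (length-++ (map (zero ,_) (row zero T)))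
          (trans (cong₂ _+_ (length-map _ (row zero T)) (length-map _ (row (suc zero) T)))
              (rowSize-sum T)))
          to from
          (take-IsTopK k (columns-decreasing b)
            (All.tabulate λ {p} p∈ → (s≤s z≤n , toℕ<n (proj₁ p)) , s≤s z≤n , columns⁻ b p∈)
            (λ { (r , q) (_ , _ , q≤b) → columns⁺ b r q q≤b }))
        where
        T = take k (columns b)

        unique : ∀ r → Unique (row r T)
        unique r = Decreasing⇒Unique (AllPairs-row r (AllPairs-take k (columns-decreasing b)))

        disjoint : ∀ {p} → ¬ (p ∈ map (zero ,_) (row zero T) ×
            p ∈ map (suc zero ,_) (row (suc zero) T))
        disjoint (p∈ , p∈′) with ∈-map⁻ _ p∈ | ∈-map⁻ _ p∈′
        ... | _ , _ , refl | _ , _ , ()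

        to : ∀ {p} → p ∈ map (zero ,_) (row zero T) ++ map (suc zero ,_) (row (suc zero) T) → p ∈ T
        to p∈ with ∈-++⁻ (map (zero ,_) (row zero T)) p∈
        ... | inj₁ p∈′ with _ , q∈ , refl ← ∈-map⁻ _ p∈′ = ∈-row⁻ T q∈
        ... | inj₂ p∈′ with _ , q∈ , refl ← ∈-map⁻ _ p∈′ = ∈-row⁻ T q∈

        from : ∀ {p} → p ∈ T → p ∈ map (zero ,_) (row zero T) ++ map (suc zero ,_)
            (row (suc zero) T)
        from {zero , q}     p∈ = ∈-++⁺ˡ (∈-map⁺ (zero ,_) (∈-row⁺ p∈))
        from {suc zero , q} p∈ = ∈-++⁺ʳ (map (zero ,_) (row zero T))
            (∈-map⁺ (suc zero ,_) (∈-row⁺ p∈))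

    oneRow : ∀ k r b {ps} → TopK₁ O k 1 b (A ∘ (r ,_)) ps →
             TopK₂ O k (pos r) (pos r) 1 b A (map (r ,_) ps)
    oneRow k r b {ps} (unique , inR , ≤k , complete , top) =
        Unique.map⁺ (cong proj₂) unique
      , All.map⁺ (All.map ((≤-refl , ≤-refl) ,_) inR)
      , subst (_≤ k) (sym (length-map _ ps)) ≤k
      , (λ short p Rp → complete′ (subst (_< k) (length-map _ ps) short) p Rp)
      , top′
      where
      sameRow : ∀ {s : Fin 2} → s ∈[ pos r ‥ pos r ] → s ≡ r
      sameRow (r≤s , s≤r) = toℕ-injective (suc-injective (≤-antisym s≤r r≤s))

      complete′ : length ps < k → ∀ p → (proj₁ p ∈[ pos r ‥ pos r ] × proj₂ p ∈[ 1 ‥ b ]) →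
          p ∈ map (r ,_) ps
      complete′ short (s , q) (Rs , Rq) with refl ← sameRow Rs = ∈-map⁺ (r ,_) (complete short q Rq)

      top′ : ∀ p q → p ∈ map (r ,_) ps → (proj₁ q ∈[ pos r ‥ pos r ] × proj₂ q ∈[ 1 ‥ b ]) →
             q ∉ map (r ,_) ps → A q <ⱽ A p
      top′ p (s , q) p∈ (Rs , Rq) q∉ with refl ← sameRow Rs | _ , p∈′ , refl ← ∈-map⁻ _ p∈ =
        top _ q p∈′ Rq (q∉ ∘ ∈-map⁺ (r ,_))

    module _ (distinct : DistinctEntries O A) (k : ℕ) {b} (b≤n : b ≤ n) {ps qs : List (Fin n)}
             (top₁ : TopK₁ O k 1 b (A ∘ (zero ,_)) ps) (dec₁ : Decreasing O (A ∘ (zero ,_)) ps)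
             (top₂ : TopK₁ O k 1 b (A ∘ (suc zero ,_)) qs) (dec₂ : Decreasing O (A ∘ (suc zero ,_)) qs) where

      -- The lengths are included because `take` may return fewer entries than asked for, whereas
      -- the program reports the numbers `c` and `d` themselves.
      Answers : (i j c d : ℕ) → Set ℓ₂
      Answers i j c d =
        TopK₂ O k i j 1 b A (map (zero ,_) (take c ps) ++ map (suc zero ,_) (take d qs)) ×
        length (take c ps) ≡ c × length (take d qs) ≡ d

      private
        K = topCount k zero b

        lengths : length ps ≡ k ⊓ b × length qs ≡ k ⊓ b
        lengths = length-sortedTop distinct k zero b≤n top₁ dec₁ ,
            length-sortedTop distinct k (suc zero) b≤n top₂ dec₂

        take-⊓ : ∀ {ps : List (Fin n)} → length ps ≡ k ⊓ b → take (k ⊓ b) ps ≡ ps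
        take-⊓ {ps} len = take-all _ ps (≤-reflexive len)

      answer₁ : Answers 1 1 (k ⊓ b) 0
      answer₁ rewrite take-⊓ {ps} (proj₁ lengths) | ++-identityʳ
          (map {B = Fin 2 × Fin n} (zero ,_) ps) =
        oneRow k zero b top₁ , proj₁ lengths , refl

      answer₂ : Answers 2 2 0 (k ⊓ b)
      answer₂ rewrite take-⊓ {qs} (proj₂ lengths) = oneRow k (suc zero) b top₂ , refl ,
          proj₂ lengths

      answer₁₂ : Answers 1 2 K ((k ⊓ (b + b)) ∸ K)
      answer₁₂ rewrite sym (topCount-sum k b≤n) | m+n∸m≡n K (topCount k (suc zero) b)
                     | topOfRow distinct k zero b top₁ dec₁ | topOfRow distinct k
                         (suc zero) b top₂ dec₂ =
        bothRows distinct k b , refl , refl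

      answers : ∀ {i j} → Rows i j → Answers i j (count₁ k i j b K) (count₂ k i j b K)
      answers first  rewrite +-identityʳ (k ⊓ b + 0 + 0) | +-identityʳ
          (k ⊓ b + 0) | +-identityʳ (k ⊓ b)
                           | n∸n≡0 (k ⊓ b) = answer₁
      answers both   rewrite +-identityʳ (K + 0) | +-identityʳ K | +-identityʳ b = answer₁₂
      answers second = answer₂

-- Ternary numerals and prefix sums of trits

divMod-unique : ∀ {r n} q .{{_ : NonZero n}} → r < n → (r + n * q) / n ≡ q × (r + n * q) % n ≡ r
divMod-unique {r} {n} q r<n =
    (begin-equality
      (r + n * q) / n      ≡⟨ +-distrib-/-∣ʳ r (m∣m*n q) ⟩
      r / n + n * q / n
        ≡⟨ cong₂ _+_ (m<n⇒m/n≡0 r<n) (trans (/-congˡ (*-comm n q)) (m*n/n≡m q n)) ⟩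
      q                    ∎)
  , (begin-equality
      (r + n * q) % n      ≡⟨ cong (λ x → (r + x) % n) (*-comm n q) ⟩
      (r + q * n) % n      ≡⟨ [m+kn]%n≡m%n r q n ⟩
      r % n                ≡⟨ m<n⇒m%n≡m r<n ⟩
      r                    ∎)
  where open ≤-Reasoning

module _ where
  open ≤-Reasoning

  infixl 7 _/3^_ _%3^_

  _/3^_ _%3^_ : ℕ → ℕ → ℕ
  x /3^ t = _/_ x (3 ^ t) {{m^n≢0 3 t}}
  x %3^ t = _%_ x (3 ^ t) {{m^n≢0 3 t}}

  divMod3^-unique : ∀ {r} t q → r < 3 ^ t → (r + 3 ^ t * q) /3^ t ≡ q × (r + 3 ^ t * q) %3^ t ≡ r
  divMod3^-unique t q = divMod-unique q {{m^n≢0 3 t}}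

  prefixSum : (ℕ → ℕ) → ℕ → ℕ
  prefixSum f zero    = 0
  prefixSum f (suc s) = prefixSum f s + f s

  prefixSum-+ : ∀ f s t → prefixSum f (s + t) ≡ prefixSum f s + prefixSum (λ i → f (s + i)) t
  prefixSum-+ f s zero    = trans (cong (prefixSum f) (+-identityʳ s)) (sym (+-identityʳ _))
  prefixSum-+ f s (suc t) = begin-equality
    prefixSum f (s + suc t)
      ≡⟨ cong (prefixSum f) (+-suc s t) ⟩
    prefixSum f (s + t) + f (s + t)
      ≡⟨ cong (_+ f (s + t)) (prefixSum-+ f s t) ⟩
    prefixSum f s + prefixSum (λ i → f (s + i)) t + f (s + t)
      ≡⟨ +-assoc (prefixSum f s) _ _ ⟩
    prefixSum f s + prefixSum (λ i → f (s + i)) (suc t)                ∎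

  prefixSum-≤ : ∀ {f m} → (∀ i → f i ≤ m) → ∀ s → prefixSum f s ≤ s * m
  prefixSum-≤ f≤m zero    = z≤n
  prefixSum-≤ {f} {m} f≤m (suc s) = subst (prefixSum f s + f s ≤_) (+-comm (s * m) m)
      (+-mono-≤ (prefixSum-≤ f≤m s) (f≤m s))

  -- Least significant trit first: reduction modulo `3 ^ p` keeps the first p trits, and division by
  -- it skips them.
  code : (ℕ → ℕ) → ℕ → ℕ
  code f zero    = 0
  code f (suc u) = f 0 + 3 * code (f ∘ suc) u

  code-+ : ∀ f s t → code f (s + t) ≡ code f s + 3 ^ s * code (λ i → f (s + i)) t
  code-+ f zero    t = sym (+-identityʳ _)
  code-+ f (suc s) t = begin-equality
    f 0 + 3 * code (f ∘ suc) (s + t)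
      ≡⟨ cong (λ x → f 0 + 3 * x) (code-+ (f ∘ suc) s t) ⟩
    f 0 + 3 * (code (f ∘ suc) s + 3 ^ s * rest)
      ≡⟨ cong (f 0 +_) (*-distribˡ-+ 3 (code (f ∘ suc) s) (3 ^ s * rest)) ⟩
    f 0 + (3 * code (f ∘ suc) s + 3 * (3 ^ s * rest))   ≡⟨ +-assoc (f 0) _ _ ⟨
    code f (suc s) + 3 * (3 ^ s * rest)
      ≡⟨ cong (code f (suc s) +_) (*-assoc 3 (3 ^ s) rest) ⟨
    code f (suc s) + 3 ^ suc s * rest                   ∎
    where rest = code (λ i → f (suc s + i)) t

  digitSum : ℕ → ℕ → ℕ
  digitSum zero    x = 0
  digitSum (suc t) x = x % 3 + digitSum t (x / 3)

  digitSum-zero : ∀ t → digitSum t 0 ≡ 0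
  digitSum-zero zero    = refl
  digitSum-zero (suc t) = digitSum-zero t

  digitSum-+ : ∀ s t x → digitSum (s + t) x ≡ digitSum s (x %3^ s) + digitSum t (x /3^ s)
  digitSum-+ zero    t x = cong (digitSum t) (sym (n/1≡n x))
  digitSum-+ (suc s) t x = begin-equality
    x % 3 + digitSum (s + t) (x / 3)
      ≡⟨ cong (x % 3 +_) (digitSum-+ s t (x / 3)) ⟩
    x % 3 + (digitSum s (x / 3 %3^ s) + digitSum t (x / 3 /3^ s))
      ≡⟨ +-assoc (x % 3) _ _ ⟨
    x % 3 + digitSum s (x / 3 %3^ s) + digitSum t (x / 3 /3^ s)
      ≡⟨ cong₂ _+_ (cong₂ (λ y z → y + digitSum s z)
           (m∣n⇒o%n%m≡o%m 3 (3 ^ suc s) x {{_}} {{m^n≢0 3 (suc s)}} (m∣m*n (3 ^ s)))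
           (trans (cong (_/ 3) (%-congʳ {o = x} {{m^n≢0 3 (suc s)}} {{nz}} (*-comm 3 (3 ^ s))))
               (m%[n*o]/o≡m/o%n x (3 ^ s) 3)))
           (cong (digitSum t) (sym (m/n/o≡m/[n*o] x 3 (3 ^ s) {{_}} {{_}} {{m^n≢0 3 (suc s)}}))) ⟨
    digitSum (suc s) (x %3^ (suc s)) + digitSum t (x /3^ (suc s)) ∎
    where instance
      3^s≢0 : NonZero (3 ^ s)
      3^s≢0 = m^n≢0 3 s
      nz : NonZero (3 ^ s * 3)
      nz = m*n≢0 (3 ^ s) 3

  -- The digit sum as the query program computes it: each summand is an entry of a table indexed by
  -- the numbers below `3 ^ t`.
  blockSum : ℕ → ℕ → ℕ → ℕ
  blockSum t zero    x = 0
  blockSum t (suc g) x = digitSum t (x %3^ t) + blockSum t g (x /3^ t)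

  blockSum≡digitSum : ∀ t g x → blockSum t g x ≡ digitSum (g * t) x
  blockSum≡digitSum t zero    x = refl
  blockSum≡digitSum t (suc g) x =
      trans (cong (digitSum t (x %3^ t) +_) (blockSum≡digitSum t g (x /3^ t)))
                                        (sym (digitSum-+ t (g * t) x))

  code-< : ∀ {f} → (∀ i → f i ≤ 2) → ∀ u → code f u < 3 ^ u
  code-<     _   zero    = s≤s z≤n
  code-< {f} f≤2 (suc u) = begin-strict
    f 0 + 3 * code (f ∘ suc) u    <⟨ s≤s (+-monoˡ-≤ (3 * code (f ∘ suc) u) (f≤2 0)) ⟩
    3 + 3 * code (f ∘ suc) u      ≡⟨ *-suc 3 (code (f ∘ suc) u) ⟨
    3 * suc (code (f ∘ suc) u)    ≤⟨ *-monoʳ-≤ 3 (code-< (f≤2 ∘ suc) u) ⟩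
    3 ^ suc u                     ∎

  -- The digits beyond the `s` encoded ones are zeros. Hence the same number of pieces can be summed
  -- up wherever in a word the query position falls.
  digitSum-code : ∀ {f} → (∀ i → f i ≤ 2) → ∀ {s t} → s ≤ t → digitSum t (code f s) ≡ prefixSum f s
  digitSum-code f≤2 {zero}  {t}     _         = digitSum-zero t
  digitSum-code {f} f≤2 {suc s} {suc t} (s≤s s≤t) = begin-equality
    code f (suc s) % 3 + digitSum t (code f (suc s) / 3)
      ≡⟨ cong₂ (λ x y → x + digitSum t y) (proj₂ divMod) (proj₁ divMod) ⟩
    f 0 + digitSum t (code (f ∘ suc) s)
      ≡⟨ cong (f 0 +_) (digitSum-code (f≤2 ∘ suc) s≤t) ⟩
    f 0 + prefixSum (f ∘ suc) s
      ≡⟨ prefixSum-+ f 1 s ⟨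
    prefixSum f (suc s) ∎
    where divMod = divMod-unique {n = 3} (code (f ∘ suc) s) (s≤s (f≤2 0))

  -- Prefix sums of a sequence of trits in constant time: each word holds u
  -- trits and, relative to the start of its group of z words, the sum of the
  -- trits before it.
  module _ (e : ℕ → ℕ) (u z : ℕ) {{_ : NonZero u}} {{_ : NonZero z}} where

    groupStart : ℕ → ℕ
    groupStart j = j / z * z * u

    relativeSum : ℕ → ℕ
    relativeSum j = prefixSum e (j * u) ∸ prefixSum e (groupStart j)

    tritWord : ℕ → ℕ
    tritWord j = code (λ i → e (j * u + i)) u + 3 ^ u * relativeSum j

    private
      start+offset : ∀ j → j * u ≡ groupStart j + (j % z) * u
      start+offset j = trans (cong (_* u) (trans (m≡m%n+[m/n]*n j z) (+-comm (j % z) _)))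
          (*-distribʳ-+ u (j / z * z) (j % z))

      split : ∀ j → prefixSum e (j * u) ≡ prefixSum e (groupStart j)
          + prefixSum (λ i → e (groupStart j + i)) ((j % z) * u)
      split j = trans (cong (prefixSum e) (start+offset j)) (prefixSum-+ e (groupStart j) _)

    -- The summands are the sums of the trits before the group, from there to the start of the word,
    -- and within the word up to position `s`. The quotient by `3 ^ u` is the relative sum, and the
    -- remainder modulo `3 ^ (s % u)` encodes exactly the trits still missing.
    prefixSum-query : (∀ i → e i ≤ 2) → ∀ {t} s → u ≤ t →
      prefixSum e (groupStart (s / u)) + tritWord (s / u) /3^ u
          + digitSum t (tritWord (s / u) %3^ (s % u)) ≡ prefixSum e s
    prefixSum-query e≤2 {t} s u≤t = begin-equality
      prefixSum e (groupStart j) + tritWord j /3^ u + digitSum t (tritWord j %3^ p)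
        ≡⟨ cong₂ (λ x y → prefixSum e (groupStart j) + x + digitSum t y)
            (proj₁ (divMod3^-unique u _ (code-< ej≤2 u))) low ⟩
      prefixSum e (groupStart j) + relativeSum j + digitSum t (code ej p)
        ≡⟨ cong₂ _+_ (trans (cong (λ x → prefixSum e (groupStart j)
            + (x ∸ prefixSum e (groupStart j))) (split j)) (trans
            (cong (prefixSum e (groupStart j) +_) (m+n∸m≡n (prefixSum e (groupStart j)) _))
            (sym (split j))))
                     (digitSum-code ej≤2 (≤-trans p≤u u≤t)) ⟩
      prefixSum e (j * u) + prefixSum ej p
        ≡⟨ prefixSum-+ e (j * u) p ⟨
      prefixSum e (j * u + p)
        ≡⟨ cong (prefixSum e) (trans (+-comm (j * u) p) (sym (m≡m%n+[m/n]*n s u))) ⟩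
      prefixSum e s ∎
      where
      j = s / u
      p = s % u
      ej = λ i → e (j * u + i)

      ej≤2 : ∀ i → ej i ≤ 2
      ej≤2 i = e≤2 _

      p≤u : p ≤ u
      p≤u = <⇒≤ (m%n<n s u)

      -- As `p ≤ u`, the trits from position `p` on and the sum above them together form a multiple
      -- of `3 ^ p`.
      low : tritWord j %3^ p ≡ code ej p
      low = begin-equality
        tritWord j %3^ p
          ≡⟨ cong (λ x → (code ej x + 3 ^ x * R) %3^ p) (m+[n∸m]≡n p≤u) ⟨
        (code ej (p + k) + 3 ^ (p + k) * R) %3^ p
          ≡⟨ cong (_%3^ p) (cong₂ _+_ (code-+ ej p k) (trans (cong (_* R) (^-distribˡ-+-* 3 p k))
              (*-assoc (3 ^ p) (3 ^ k) R))) ⟩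
        (code ej p + 3 ^ p * c + 3 ^ p * (3 ^ k * R)) %3^ p
          ≡⟨ cong (_%3^ p) (trans (+-assoc (code ej p) _ _) (cong (code ej p +_)
              (sym (*-distribˡ-+ (3 ^ p) c _)))) ⟩
        (code ej p + 3 ^ p * (c + 3 ^ k * R)) %3^ p
          ≡⟨ proj₂ (divMod3^-unique p _ (code-< ej≤2 p)) ⟩
        code ej p ∎
        where
        k = u ∸ p
        R = relativeSum j
        c = code (λ i → ej (p + i)) k

    -- At most `z ∸ 1` words of its group precede word `j`, each with `u` trits that are at most 2.
    tritWord-< : (∀ i → e i ≤ 2) → ∀ {v} → (z ∸ 1) * u * 2 < 3 ^ v → ∀ j → tritWord j < 3 ^ (u + v)
    tritWord-< e≤2 {v} small j = begin-strict
      code ej u + 3 ^ u * relativeSum j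
        <⟨ +-monoˡ-< (3 ^ u * relativeSum j) (code-< (λ _ → e≤2 _) u) ⟩
      3 ^ u + 3 ^ u * relativeSum j        ≡⟨ *-suc (3 ^ u) (relativeSum j) ⟨
      3 ^ u * suc (relativeSum j)          ≤⟨ *-monoʳ-≤ (3 ^ u) (≤-trans (s≤s relative≤) small) ⟩
      3 ^ u * 3 ^ v                        ≡⟨ ^-distribˡ-+-* 3 u v ⟨
      3 ^ (u + v)                          ∎
      where
      ej = λ i → e (j * u + i)

      relative≤ : relativeSum j ≤ (z ∸ 1) * u * 2
      relative≤ = begin
        relativeSum j
          ≡⟨ cong (_∸ prefixSum e (groupStart j)) (split j) ⟩
        prefixSum e (groupStart j) + rest ∸ prefixSum e (groupStart j)
          ≡⟨ m+n∸m≡n (prefixSum e (groupStart j)) rest ⟩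
        rest
          ≤⟨ prefixSum-≤ (λ _ → e≤2 _) ((j % z) * u) ⟩
        j % z * u * 2
          ≤⟨ *-monoˡ-≤ 2 (*-monoˡ-≤ u (<⇒≤pred (m%n<n j z))) ⟩
        (z ∸ 1) * u * 2                                              ∎
        where rest = prefixSum (λ i → e (groupStart j + i)) ((j % z) * u)

-- The number of positions in row 1 as a prefix sum of trits

module Differences (K : ℕ → ℕ) (h : ℕ) (K-suc : ∀ b → K (suc b) ≤ suc (K b))
    (K-pred : ∀ b → K b ≤ suc (K (suc b)))
                   (K≤h : ∀ {b} → b ≤ h → K b ≡ b) where

  -- The change of `K`, shifted by one so as to lie between 0 and 2; by `K-pred` the subtraction is
  -- not cut off. The sequence starts at column `h`, up to which `K` is the identity.
  trit : ℕ → ℕ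
  trit s = suc (K (suc (h + s))) ∸ K (h + s)

  trit≤2 : ∀ s → trit s ≤ 2
  trit≤2 s = m≤n+o⇒m∸n≤o (suc (K (suc (h + s)))) (K (h + s))
    (≤-trans (s≤s (K-suc (h + s))) (≤-reflexive (+-comm 2 (K (h + s)))))

  -- The differences telescope down to `K h`, which is `h`; the shifts add up to `s`.
  prefixSum-trit : ∀ s → prefixSum trit s + h ≡ K (h + s) + s
  prefixSum-trit zero    = sym (trans (+-identityʳ _) (trans (cong K (+-identityʳ h)) (K≤h ≤-refl)))
  prefixSum-trit (suc s) = begin
    prefixSum trit s + trit s + h             ≡⟨ swap (prefixSum trit s) (trit s) h ⟩
    trit s + (prefixSum trit s + h)           ≡⟨ cong (trit s +_) (prefixSum-trit s) ⟩
    trit s + (K (h + s) + s)                  ≡⟨ +-assoc (trit s) (K (h + s)) s ⟨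
    trit s + K (h + s) + s                    ≡⟨ cong (_+ s) (m∸n+n≡m (K-pred (h + s))) ⟩
    suc (K (suc (h + s))) + s                 ≡⟨ +-suc (K (suc (h + s))) s ⟨
    K (suc (h + s)) + suc s                   ≡⟨ cong (λ b → K b + suc s) (+-suc h s) ⟨
    K (h + suc s) + suc s                     ∎
    where
    open ≡-Reasoning
    swap : ∀ p t h → p + t + h ≡ t + (p + h)
    swap = solve-∀

  -- For b = h + s and the prefix sum E of s trits, telescoping yields K b = E + h - s = b - (2s -
  -- E). In this form no difference is negative, and for b ≤ h truncation makes the bracket vanish
  -- and leaves b, so the program needs no case distinction.
  recover : ∀ b → b ∸ (2 * (b ∸ h) ∸ prefixSum trit (b ∸ h)) ≡ K b
  recover b with ≤-total b h
  ... | inj₁ b≤h rewrite m≤n⇒m∸n≡0 b≤h = sym (K≤h b≤h)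
  ... | inj₂ h≤b = begin
    b ∸ d              ≡⟨ cong (_∸ d) K+d≡b ⟨
    K b + d ∸ d        ≡⟨ m+n∸n≡m (K b) d ⟩
    K b                ∎
    where
    open ≡-Reasoning
    s = b ∸ h
    E = prefixSum trit s
    d = 2 * s ∸ E

    d+E : d + E ≡ 2 * s
    d+E = m∸n+n≡m (≤-trans (prefixSum-≤ trit≤2 s) (≤-reflexive (*-comm s 2)))

    K+d≡b : K b + d ≡ b
    K+d≡b = +-cancelʳ-≡ s (K b + d) b (begin
      K b + d + s            ≡⟨ swap (K b) d s ⟩
      K b + s + d            ≡⟨ cong (λ x → K x + s + d) (m+[n∸m]≡n h≤b) ⟨
      K (h + s) + s + d      ≡⟨ cong (_+ d) (prefixSum-trit s) ⟨
      E + h + d              ≡⟨ swap′ E h d ⟩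
      h + (d + E)            ≡⟨ cong (h +_) d+E ⟩
      h + 2 * s              ≡⟨ swap″ h s ⟩
      h + s + s              ≡⟨ cong (_+ s) (m+[n∸m]≡n h≤b) ⟩
      b + s                  ∎)
      where
      swap : ∀ K d s → K + d + s ≡ K + s + d
      swap = solve-∀
      swap′ : ∀ E h d → E + h + d ≡ h + (d + E)
      swap′ = solve-∀
      swap″ : ∀ h s → h + 2 * s ≡ h + s + s
      swap″ = solve-∀

-- Bit strings, words and their storage

infixl 7 _%2^_
_%2^_ : ℕ → ℕ → ℕ
x %2^ w = _%_ x (2 ^ w) {{m^n≢0 2 w}}

%2^-< : ∀ x w → x %2^ w < 2 ^ w
%2^-< x w = m%n<n x (2 ^ w) {{m^n≢0 2 w}}

<2^⇒%2^ : ∀ {x w} → x < 2 ^ w → x %2^ w ≡ x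
<2^⇒%2^ {w = w} = m<n⇒m%n≡m {{m^n≢0 2 w}}

length-toBits : ∀ w x → length (toBits w x) ≡ w
length-toBits zero    x = refl
length-toBits (suc w) x = cong suc (length-toBits w (x / 2))

fromBits-toBits : ∀ w x → fromBits (toBits w x) ≡ x %2^ w
fromBits-toBits zero    x = sym (n%1≡0 x)
fromBits-toBits (suc w) x = begin
  fromBits (toBits (suc w) x)              ≡⟨ head x (toBits w (x / 2)) ⟩
  x % 2 + 2 * fromBits (toBits w (x / 2))
    ≡⟨ cong (λ y → x % 2 + 2 * y) (fromBits-toBits w (x / 2)) ⟩
  x % 2 + 2 * (x / 2 %2^ w)                ≡⟨ cong₂ (λ y z → y + 2 * z) low high ⟨
  y % 2 + 2 * (y / 2)                      ≡⟨ cong (y % 2 +_) (*-comm 2 (y / 2)) ⟩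
  y % 2 + y / 2 * 2                        ≡⟨ m≡m%n+[m/n]*n y 2 ⟨
  y                                        ∎
  where
  open ≡-Reasoning
  y = x %2^ suc w

  head : ∀ x bs → fromBits ((x % 2 ≡ᵇ 1) ∷ bs) ≡ x % 2 + 2 * fromBits bs
  head x bs with x % 2 | m%n<n x 2
  ... | 0 | _ = refl
  ... | 1 | _ = refl
  ... | suc (suc _) | s≤s (s≤s ())

  low : y % 2 ≡ x % 2
  low = m∣n⇒o%n%m≡o%m 2 (2 ^ suc w) x {{_}} {{m^n≢0 2 (suc w)}} (m∣m*n (2 ^ w))

  high : y / 2 ≡ x / 2 %2^ w
  high = trans (cong (_/ 2) (%-congʳ {o = x} {{m^n≢0 2 (suc w)}} {{nz}} (*-comm 2 (2 ^ w))))
               (m%[n*o]/o≡m/o%n x (2 ^ w) 2)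
    where instance
      2^w≢0 : NonZero (2 ^ w)
      2^w≢0 = m^n≢0 2 w
      nz : NonZero (2 ^ w * 2)
      nz = m*n≢0 (2 ^ w) 2

fromBits-< : ∀ bs → fromBits bs < 2 ^ length bs
fromBits-< []           = s≤s z≤n
fromBits-< (true  ∷ bs) = ≤-trans (≤-reflexive (sym (*-suc 2 (fromBits bs))))
    (*-monoʳ-≤ 2 (fromBits-< bs))
fromBits-< (false ∷ bs) = *-monoʳ-< 2 (fromBits-< bs)

take-++-≡ : ∀ {a} {A : Set a} {n} (xs ys : List A) → length xs ≡ n → take n (xs ++ ys) ≡ xs
take-++-≡ []       ys refl = refl
take-++-≡ (x ∷ xs) ys refl = cong (x ∷_) (take-++-≡ xs ys refl)

drop-++-+ : ∀ {a} {A : Set a} {n} (xs ys : List A) i → length xs ≡ n →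
    drop (n + i) (xs ++ ys) ≡ drop i ys
drop-++-+ []       ys i refl = refl
drop-++-+ (x ∷ xs) ys i refl = drop-++-+ xs ys i refl

module _ (w : ℕ) where

  serialise : List ℕ → BitString
  serialise = concatMap (toBits w)

  length-serialise : ∀ xs → length (serialise xs) ≡ length xs * w
  length-serialise []       = refl
  length-serialise (x ∷ xs) =
    trans (length-++ (toBits w x)) (cong₂ _+_ (length-toBits w x) (length-serialise xs))

  chunk : BitString → ℕ → ℕ
  chunk β i = fromBits (take w (drop (i * w) β))

  chunk-< : ∀ β i → chunk β i < 2 ^ w
  chunk-< β i = ≤-trans (fromBits-< (take w (drop (i * w) β)))
    (^-monoʳ-≤ 2 (≤-trans (≤-reflexive (length-take w _)) (m⊓n≤m w _)))

  -- Modulo 2 ^ w, as only an encoding that fits into the address space has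
  -- pointers that are words.
  Segment : Memory w → ℕ → List ℕ → Set
  Segment m x []       = ⊤
  Segment m x (v ∷ vs) = Cell w m x (v %2^ w) × Segment m (suc x) vs

  Segment-++ : ∀ {m x} us {vs} → Segment m x (us ++ vs) → Segment m x us ×
      Segment m (x + length us) vs
  Segment-++ {m} {x} [] {vs} s = tt , subst (λ y → Segment m y vs) (sym (+-identityʳ x)) s
  Segment-++ {m} {x} (u ∷ us) {vs} (c , s) with s₁ , s₂ ← Segment-++ us s =
    (c , s₁) , subst (λ y → Segment m y vs) (sym (+-suc x (length us))) s₂

  Segment-applyUpTo : ∀ {m x} f {n} → Segment m x (applyUpTo f n) →
                      ∀ {i} → i < n → f i < 2 ^ w → Cell w m (x + i) (f i)
  Segment-applyUpTo {m} {x} f {suc n} (c , _) {zero}  _ f< =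
    subst₂ (Cell w m) (sym (+-identityʳ x)) (<2^⇒%2^ {w = w} f<) c
  Segment-applyUpTo {m} {x} f {suc n} (_ , s) {suc i} (s≤s i<n) f< =
    subst (λ y → Cell w m y (f (suc i))) (sym (+-suc x i)) (Segment-applyUpTo (f ∘ suc) s i<n f<)

  module _ {{_ : NonZero w}} where

    StoredAt⇒Segment : ∀ {m} x vs → StoredAt w m x (serialise vs) → Segment m x vs
    StoredAt⇒Segment {m} x []       _      = tt
    StoredAt⇒Segment {m} x (v ∷ vs) stored =
        subst₂ (Cell w m) (+-identityʳ x)
          (trans (cong fromBits (take-++-≡ (toBits w v) (serialise vs) (length-toBits w v)))
              (fromBits-toBits w v))
          (stored 0 (≤-trans (>-nonZero⁻¹ w) (≤-trans (m≤m+n w _)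
              (≤-reflexive (sym (length-serialise (v ∷ vs)))))))
      , StoredAt⇒Segment (suc x) vs λ i i< →
          subst₂ (Cell w m) (+-suc x i)
            (cong (fromBits ∘ take w) (drop-++-+ (toBits w v) (serialise vs) (i * w)
                (length-toBits w v)))
            (stored (suc i) (subst (suc i * w <_) (sym (length-serialise (v ∷ vs)))
              (+-monoʳ-< w (subst (i * w <_) (length-serialise vs) i<))))

    -- A row encoding is cut into whole words, so that it starts at a word boundary as the calling
    -- convention demands. Taking the quotient plus one as the number of words may append a word of
    -- zeros; the excess is at most `w` bits in any case.
    chunks : BitString → List ℕ
    chunks β = applyUpTo (chunk β) (suc (length β / w))

    Segment-chunks : ∀ {m x} β → Segment m x (chunks β) → StoredAt w m x β
    Segment-chunks β s i i< = Segment-applyUpTo (chunk β) s (s≤s i≤) (chunk-< β i)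
      where
      i≤ : i ≤ length β / w
      i≤ = subst (_≤ length β / w) (m*n/n≡m i w) (/-monoˡ-≤ w (<⇒≤ i<))

    chunks-bits : ∀ β → length (chunks β) * w ≤ length β + w
    chunks-bits β = ≤-trans (≤-reflexive
        (cong (_* w) (length-applyUpTo (chunk β) (suc (length β / w)))))
      (≤-trans (+-monoʳ-≤ w (m/n*n≤m (length β) w)) (≤-reflexive (+-comm w _)))

Cell-< : ∀ {w m x v} → Cell w m x v → x < 2 ^ w × v < 2 ^ w
Cell-< {m = m} (a , refl , refl) = toℕ<n a , toℕ<n (m a)

module _ (w : ℕ) where

  -- Recursive form of `Holds`, which is easier to shorten and to join.
  HoldsFrom : Memory w → ℕ → List ℕ → Set
  HoldsFrom m x []       = ⊤
  HoldsFrom m x (v ∷ vs) = Cell w m x v × HoldsFrom m (suc x) vs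

  Holds⇒HoldsFrom : ∀ {m} x vs → Holds w m x vs → HoldsFrom m x vs
  Holds⇒HoldsFrom     x []       _     = tt
  Holds⇒HoldsFrom {m} x (v ∷ vs) holds =
      subst (λ y → Cell w m y v) (+-identityʳ x) (holds zero)
    , Holds⇒HoldsFrom (suc x) vs (λ i → subst (λ y → Cell w m y (lookup vs i)) (+-suc x (toℕ i))
        (holds (suc i)))

  HoldsFrom⇒Holds : ∀ {m} x vs → HoldsFrom m x vs → Holds w m x vs
  HoldsFrom⇒Holds {m} x (v ∷ vs) (c , _) zero    = subst (λ y → Cell w m y v)
      (sym (+-identityʳ x)) c
  HoldsFrom⇒Holds {m} x (v ∷ vs) (_ , h) (suc i) =
    subst (λ y → Cell w m y (lookup vs i)) (sym (+-suc x (toℕ i))) (HoldsFrom⇒Holds (suc x) vs h i)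

  HoldsFrom-take : ∀ {m x} c vs → HoldsFrom m x vs → HoldsFrom m x (take c vs)
  HoldsFrom-take zero    vs       _        = tt
  HoldsFrom-take (suc c) []       _        = tt
  HoldsFrom-take (suc c) (v ∷ vs) (cv , h) = cv , HoldsFrom-take c vs h

  HoldsFrom-++ : ∀ {m x} us {vs} → HoldsFrom m x us → HoldsFrom m (x + length us) vs →
      HoldsFrom m x (us ++ vs)
  HoldsFrom-++ {m} {x} []       {vs} _       h = subst (λ y → HoldsFrom m y vs) (+-identityʳ x) h
  HoldsFrom-++ {m} {x} (u ∷ us) {vs} (c , g) h =
    c , HoldsFrom-++ us g (subst (λ y → HoldsFrom m y vs) (+-suc x (length us)) h)

  HoldsFrom-frame : ∀ {m m′ : Memory w} {x} vs → (∀ a → toℕ a < x + length vs → m′ a ≡ m a) →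
      HoldsFrom m x vs → HoldsFrom m′ x vs
  HoldsFrom-frame         []       same _                        = tt
  HoldsFrom-frame {x = x} (v ∷ vs) same ((a , refl , eqv) , h) =
      (a , refl , trans (cong toℕ
          (same a (subst (toℕ a <_) (sym (+-suc x _)) (s≤s (m≤m+n x _))))) eqv)
    , HoldsFrom-frame vs (λ a a< → same a (subst (toℕ a <_) (sym (+-suc x _)) a<)) h

-- Straight-line expressions on the word RAM

data Expr : Set where
  con : ℕ → Expr
  var : Reg → Expr
  bin : Op → Expr → Expr → Expr
  mem : Expr → Expr

-- Evaluates into register d, using the registers from d on; the variables are
-- the registers from M on.
compile : Reg → Expr → Reg → Prog
compile M (con c)     d = const d c
compile M (var r)     d = copy d (r + M)
compile M (bin o x y) d = compile M x d ⨾ compile M y (suc d) ⨾ op d o d (suc d)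
compile M (mem x)     d = compile M x d ⨾ read d d

-- Without loops and branches, the running time depends on the expression alone; this makes the
-- overhead of a query constant.
time : Expr → ℕ
time (con c)     = 1
time (var r)     = 1
time (bin o x y) = time x + (time y + 1)
time (mem x)     = time x + 1

compileAll : Reg → List Expr → Reg → Prog
compileAll M []       d = skip
compileAll M (x ∷ xs) d = compile M x d ⨾ compileAll M xs (suc d)

loadRegs : List Reg → Reg → Prog
loadRegs []       d = skip
loadRegs (r ∷ rs) d = copy d r ⨾ loadRegs rs (suc d)

-- Bounds the registers that are written, not those that are read: everything from there on survives
-- a run of the program.
regBound : Prog → ℕ
regBound skip         = 0
regBound (P ⨾ Q)      = regBound P ⊔ regBound Q
regBound (const r c)  = suc r
regBound (copy r p)   = suc r
regBound (op r o p q) = suc r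
regBound (read r a)   = suc r
regBound (load r a)   = suc r
regBound (store a r)  = 0
regBound (write a r)  = 0
regBound (ifnz r P Q) = regBound P ⊔ regBound Q
regBound (while r P)  = regBound P

module _ {w : ℕ} where

  setReg-≡ : ∀ r {v} {σ : State w} → reg (setReg r v σ) r ≡ v
  setReg-≡ r rewrite dec-true (r ≟ℕ r) refl = refl

  setReg-≢ : ∀ {r q v} {σ : State w} → q ≢ r → reg (setReg r v σ) q ≡ reg σ q
  setReg-≢ {r} {q} q≢r rewrite dec-false (q ≟ℕ r) q≢r = refl

  toℕ-word : ∀ x → toℕ (word w x) ≡ x %2^ w
  toℕ-word x = toℕ-fromℕ< _

  frame : ∀ {rom : Memory w} {P} {σ σ′ : State w} {t r} → regBound P ≤ r → rom ⊢ P , σ ⇓ σ′ [ t ] →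
      reg σ′ r ≡ reg σ r
  frame P≤ ⇓skip          = refl
  frame P≤ (⇓seq {P} {Q} p q) = trans (frame (m⊔n≤o⇒n≤o (regBound P) (regBound Q) P≤) q)
                                      (frame (m⊔n≤o⇒m≤o (regBound P) (regBound Q) P≤) p)
  frame P≤ (⇓const {σ = σ}) = setReg-≢ {σ = σ} (>⇒≢ P≤)
  frame P≤ (⇓copy {σ = σ})  = setReg-≢ {σ = σ} (>⇒≢ P≤)
  frame P≤ (⇓op {σ = σ})    = setReg-≢ {σ = σ} (>⇒≢ P≤)
  frame P≤ (⇓read {σ = σ})  = setReg-≢ {σ = σ} (>⇒≢ P≤)
  frame P≤ (⇓load {σ = σ})  = setReg-≢ {σ = σ} (>⇒≢ P≤)
  frame P≤ ⇓store         = refl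
  frame P≤ ⇓write         = refl
  frame P≤ (⇓then {P = P} {Q} _ p) = frame (m⊔n≤o⇒m≤o (regBound P) (regBound Q) P≤) p
  frame P≤ (⇓else {P = P} {Q} _ q) = frame (m⊔n≤o⇒n≤o (regBound P) (regBound Q) P≤) q
  frame P≤ (⇓done _)      = refl
  frame P≤ (⇓loop _ p q)  = trans (frame P≤ q) (frame P≤ p)

  RegsFrom : State w → Reg → List ℕ → Set
  RegsFrom σ d []       = ⊤
  RegsFrom σ d (v ∷ vs) = toℕ (reg σ d) ≡ v × RegsFrom σ (suc d) vs

  RegsFrom-frame : ∀ {σ σ′ d} vs → (∀ r → d ≤ r → r < d + length vs → reg σ′ r ≡ reg σ r) →
      RegsFrom σ d vs → RegsFrom σ′ d vs
  RegsFrom-frame         []       same _          = tt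
  RegsFrom-frame {d = d} (v ∷ vs) same (eqv , eqs) =
      trans (cong toℕ (same d ≤-refl (subst (suc d ≤_) (sym (+-suc d _)) (s≤s (m≤m+n d _))))) eqv
    , RegsFrom-frame vs (λ r d<r r< → same r (<⇒≤ d<r) (subst (r <_) (sym (+-suc d _)) r<)) eqs

  RegsFrom⇒RegsHold : ∀ {σ} vs → RegsFrom σ 0 vs → RegsHold σ vs
  RegsFrom⇒RegsHold {σ} = go 0
    where
    go : ∀ d vs → RegsFrom σ d vs → (i : Fin (length vs)) → toℕ (reg σ (d + toℕ i)) ≡ lookup vs i
    go d (v ∷ vs) (eqv , _) zero = trans (cong (toℕ ∘ reg σ) (+-identityʳ d)) eqv
    go d (v ∷ vs) (_ , eqs) (suc i) = trans (cong (toℕ ∘ reg σ) (+-suc d (toℕ i)))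
        (go (suc d) vs eqs i)

  RegsHold⇒RegsFrom : ∀ {σ} vs → RegsHold σ vs → RegsFrom σ 0 vs
  RegsHold⇒RegsFrom {σ} vs hold = go 0 vs hold
    where
    go : ∀ d vs → ((i : Fin (length vs)) → toℕ (reg σ (d + toℕ i)) ≡ lookup vs i) → RegsFrom σ d vs
    go d []       _    = tt
    go d (v ∷ vs) hold = trans (cong (toℕ ∘ reg σ) (sym (+-identityʳ d))) (hold zero)
                       , go (suc d) vs (λ i → trans (cong (toℕ ∘ reg σ) (sym (+-suc d (toℕ i))))
                           (hold (suc i)))

  -- The sources lie from `M` on and the targets below `M`, so no copy destroys a later source.
  loadRegs-correct : ∀ {rom : Memory w} {M} rs vs d σ → d + length rs ≤ M →
                 Pointwise (λ r v → M ≤ r × toℕ (reg σ r) ≡ v) rs vs →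
                 Σ (State w) λ σ′ → (rom ⊢ loadRegs rs d , σ ⇓ σ′ [ length rs ]) ×
                     RegsFrom σ′ d vs ×
                   (∀ r → r < d ⊎ M ≤ r → reg σ′ r ≡ reg σ r) × out σ′ ≡ out σ
  loadRegs-correct []       .[]      d σ d≤M [] = σ , ⇓skip , tt , (λ _ _ → refl) , refl
  loadRegs-correct {M = M} (r ∷ rs) (v ∷ vs) d σ d≤M ((M≤r , eqv) ∷ pw) =
    let σ₁ = setReg d (reg σ r) σ
        σ′ , run , regs , same , outs = loadRegs-correct rs vs (suc d) σ₁
            (subst (_≤ M) (+-suc d _) d≤M) (Pointwise.map high pw)
    in
      σ′ , ⇓seq ⇓copy run
    , (trans (cong toℕ (trans (same d (inj₁ ≤-refl)) (setReg-≡ d {σ = σ}))) eqv , regs)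
    , (λ { q (inj₁ q<d) → trans (same q (inj₁ (m<n⇒m<1+n q<d))) (setReg-≢ {σ = σ} (<⇒≢ q<d))
         ; q (inj₂ M≤q) → trans (same q (inj₂ M≤q)) (setReg-≢ {σ = σ} (>⇒≢ (≤-trans d<M M≤q))) })
    , outs
    where
    d<M : d < M
    d<M = ≤-trans (subst (suc d ≤_) (sym (+-suc d _)) (s≤s (m≤m+n d _))) d≤M

    high : ∀ {q u} → M ≤ q × toℕ (reg σ q) ≡ u → M ≤ q × toℕ (reg (setReg d (reg σ r) σ) q) ≡ u
    high (M≤q , eqq) = M≤q , trans (cong toℕ (setReg-≢ {σ = σ} (>⇒≢ (≤-trans d<M M≤q)))) eqq

  module Evaluation (rom : Memory w) (σ₀ : State w) (M d₀ : Reg) where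

    infix 4 _⇝_

    -- The value is what the register holds after reduction modulo `2 ^ w`. To derive an unreduced
    -- value is thus to prove that nothing overflows, while a deliberate wrap-around can still be
    -- expressed.
    data _⇝_ : Expr → ℕ → Set where
      con : ∀ {c} → c < 2 ^ w → con c ⇝ c
      var : ∀ {r v} → r + M < d₀ → toℕ (reg σ₀ (r + M)) ≡ v → var r ⇝ v
      bin : ∀ {o x y a b v} → x ⇝ a → y ⇝ b → ⟦ o ⟧ w a b %2^ w ≡ v → bin o x y ⇝ v
      mem : ∀ {x a v} → x ⇝ a → Cell w rom a v → mem x ⇝ v

    ⇝-< : ∀ {x v} → x ⇝ v → v < 2 ^ w
    ⇝-< (con c<)                        = c<
    ⇝-< (var {r} _ refl)                = toℕ<n (reg σ₀ (r + M))
    ⇝-< (bin {o} {a = a} {b} _ _ refl) = %2^-< (⟦ o ⟧ w a b) w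
    ⇝-< (mem _ c)                       = proj₂ (Cell-< {w} {rom} c)

    Fresh : Reg → State w → Set
    Fresh d σ = d₀ ≤ d × (∀ r → r < d₀ → reg σ r ≡ reg σ₀ r)

    compile-correct : ∀ {x v} → x ⇝ v → ∀ d σ → Fresh d σ →
                      Σ (State w) λ σ′ → (rom ⊢ compile M x d , σ ⇓ σ′ [ time x ]) ×
                        toℕ (reg σ′ d) ≡ v × (∀ r → r < d → reg σ′ r ≡ reg σ r) × out σ′ ≡ out σ
    compile-correct (con {c} c<) d σ _ =
        _ , ⇓const , trans (cong toℕ (setReg-≡ d {σ = σ})) (trans (toℕ-word c) (<2^⇒%2^ {w = w} c<))
      , (λ r r<d → setReg-≢ {σ = σ} (<⇒≢ r<d)) , refl
    compile-correct (var {r} r< eqv) d σ (d₀≤d , same) =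
        _ , ⇓copy , trans (cong toℕ (trans (setReg-≡ d {σ = σ}) (same (r + M) r<))) eqv
      , (λ r r<d → setReg-≢ {σ = σ} (<⇒≢ r<d)) , refl
    compile-correct (mem {x} x⇝ (a , refl , cv)) d σ fresh
      with σ₁ , run , eqx , same , outs ← compile-correct x⇝ d σ fresh =
        _ , ⇓seq run ⇓read
      , trans (cong toℕ (setReg-≡ d {σ = σ₁})) (trans (cong (toℕ ∘ rom) (toℕ-injective eqx)) cv)
      , (λ r r<d → trans (setReg-≢ {σ = σ₁} (<⇒≢ r<d)) (same r r<d)) , outs
    compile-correct (bin {o} {x} {y} {a} {b} x⇝ y⇝ eqv) d σ fresh@(d₀≤d , same₀)
      with σ₁ , run₁ , eqx , same₁ , outs₁ ← compile-correct x⇝ d σ fresh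
      with σ₂ , run₂ , eqy , same₂ , outs₂ ← compile-correct y⇝ (suc d) σ₁
             (≤-trans d₀≤d (n≤1+n d) , λ r r< → trans (same₁ r (≤-trans r< d₀≤d)) (same₀ r r<)) =
        _ , ⇓seq run₁ (⇓seq run₂ ⇓op)
      , trans (cong toℕ (setReg-≡ d {σ = σ₂}))
        (trans (toℕ-word (⟦ o ⟧ w (toℕ (reg σ₂ d)) (toℕ (reg σ₂ (suc d)))))
        (trans (cong₂ (λ a b → ⟦ o ⟧ w a b %2^ w) (trans (cong toℕ (same₂ d ≤-refl)) eqx) eqy) eqv))
      , (λ r r<d → trans (setReg-≢ {σ = σ₂} (<⇒≢ r<d)) (trans (same₂ r (m<n⇒m<1+n r<d))
          (same₁ r r<d)))
      , trans outs₂ outs₁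

    compileAll-correct : ∀ {xs vs} → Pointwise _⇝_ xs vs → ∀ d σ → Fresh d σ →
                         Σ (State w) λ σ′ → (rom ⊢ compileAll M xs d ,
                             σ ⇓ σ′ [ sum (map time xs) ]) ×
                           RegsFrom σ′ d vs × (∀ r → r < d → reg σ′ r ≡ reg σ r) × out σ′ ≡ out σ
    compileAll-correct []          d σ _ = σ , ⇓skip , tt , (λ _ _ → refl) , refl
    compileAll-correct (x⇝ ∷ xs⇝) d σ fresh@(d₀≤d , same₀)
      with σ₁ , run₁ , eqx , same₁ , outs₁ ← compile-correct x⇝ d σ fresh
      with σ₂ , run₂ , eqs , same₂ , outs₂ ← compileAll-correct xs⇝ (suc d) σ₁
             (≤-trans d₀≤d (n≤1+n d) , λ r r< → trans (same₁ r (≤-trans r< d₀≤d)) (same₀ r r<)) =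
        σ₂ , ⇓seq run₁ run₂ , (trans (cong toℕ (same₂ d ≤-refl)) eqx , eqs)
      , (λ r r<d → trans (same₂ r (m<n⇒m<1+n r<d)) (same₁ r r<d)) , trans outs₂ outs₁

-- Machine subtraction wraps around if the first operand is smaller; the comparison, used as a
-- factor, then replaces the result by 0.
monus min : Expr → Expr → Expr
monus x y = bin mul (bin sub x y) (bin lt y x)
min x y = monus x (monus x y)

module _ {w} {rom : Memory w} {σ₀ : State w} {M d₀ : Reg} where

  open Evaluation rom σ₀ M d₀

  private
    variable
      x y : Expr
      a b : ℕ

  add⇝ : x ⇝ a → y ⇝ b → a + b < 2 ^ w → bin add x y ⇝ a + b
  add⇝ x⇝ y⇝ a+b< = bin x⇝ y⇝ (<2^⇒%2^ {w = w} a+b<)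

  mul⇝ : x ⇝ a → y ⇝ b → a * b < 2 ^ w → bin mul x y ⇝ a * b
  mul⇝ x⇝ y⇝ ab< = bin x⇝ y⇝ (<2^⇒%2^ {w = w} ab<)

  div⇝ : x ⇝ a → y ⇝ b → .{{_ : NonZero b}} → bin div x y ⇝ a / b
  div⇝ {a = a} {b = suc b} x⇝ y⇝ =
      bin x⇝ y⇝ (<2^⇒%2^ {w = w} (≤-<-trans (m/n≤m a (suc b)) (⇝-< x⇝)))

  mod⇝ : x ⇝ a → y ⇝ b → .{{_ : NonZero b}} → bin mod x y ⇝ a % b
  mod⇝ {a = a} {b = suc b} x⇝ y⇝ =
      bin x⇝ y⇝ (<2^⇒%2^ {w = w} (≤-<-trans (m%n≤m a (suc b)) (⇝-< x⇝)))

  lt⇝ : x ⇝ a → y ⇝ b → bin lt x y ⇝ ⟦ lt ⟧ 0 a b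
  lt⇝ {a = a} {b = b} x⇝ y⇝ = bin x⇝ y⇝ (<2^⇒%2^ {w = w} bound)
    where
    -- Even 1 must be shown to be a word, as nothing is assumed about `w`: if a < b, then 1 ≤ b, and
    -- b is a word.
    bound : ⟦ lt ⟧ 0 a b < 2 ^ w
    bound with a <ᵇ b in a<b
    ... | true  = ≤-<-trans (≤-trans (s≤s z≤n) (<ᵇ⇒< a b (subst Bool.T (sym a<b) tt))) (⇝-< y⇝)
    ... | false = ≤-<-trans z≤n (⇝-< x⇝)

  monus⇝ : x ⇝ a → y ⇝ b → monus x y ⇝ a ∸ b
  monus⇝ {a = a} {b = b} x⇝ y⇝ = bin (bin x⇝ y⇝ refl) (lt⇝ y⇝ x⇝) value
    where
    a∸b< : a ∸ b < 2 ^ w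
    a∸b< = ≤-<-trans (m∸n≤m a b) (⇝-< x⇝)

    value : ((a + (2 ^ w ∸ b)) %2^ w) * ⟦ lt ⟧ 0 b a %2^ w ≡ a ∸ b
    value with b <ᵇ a in b<a
    ... | false = trans (cong (_%2^ w) (*-zeroʳ ((a + (2 ^ w ∸ b)) %2^ w)))
                 (trans (<2^⇒%2^ {0} {w} (≤-<-trans z≤n (⇝-< x⇝)))
                        (sym (m≤n⇒m∸n≡0 {a} {b} (≮⇒≥ λ b<a′ → subst Bool.T b<a (<⇒<ᵇ b<a′)))))
    ... | true  = trans (cong (_%2^ w) (trans (*-identityʳ _) wrap)) (<2^⇒%2^ {w = w} a∸b<)
      where
      b≤a : b ≤ a
      b≤a = <⇒≤ (<ᵇ⇒< b a (subst Bool.T (sym b<a) tt))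

      wrap : (a + (2 ^ w ∸ b)) %2^ w ≡ a ∸ b
      wrap = begin
        (a + (2 ^ w ∸ b)) %2^ w           ≡⟨ cong (λ c → (c + (2 ^ w ∸ b)) %2^ w) (m∸n+n≡m b≤a) ⟨
        (a ∸ b + b + (2 ^ w ∸ b)) %2^ w   ≡⟨ cong (_%2^ w) (+-assoc (a ∸ b) b _) ⟩
        (a ∸ b + (b + (2 ^ w ∸ b))) %2^ w
          ≡⟨ cong (λ c → (a ∸ b + c) %2^ w) (m+[n∸m]≡n (<⇒≤ (⇝-< y⇝))) ⟩
        (a ∸ b + 2 ^ w) %2^ w             ≡⟨ [m+n]%n≡m%n (a ∸ b) (2 ^ w) {{m^n≢0 2 w}} ⟩
        (a ∸ b) %2^ w                     ≡⟨ <2^⇒%2^ {w = w} a∸b< ⟩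
        a ∸ b                             ∎
        where open ≡-Reasoning

  min⇝ : x ⇝ a → y ⇝ b → min x y ⇝ a ⊓ b
  min⇝ {a = a} {b = b} x⇝ y⇝ = subst (min _ _ ⇝_) (m∸[m∸n]≡m⊓n a b) (monus⇝ x⇝ (monus⇝ x⇝ y⇝))
    where
    m∸[m∸n]≡m⊓n : ∀ m n → m ∸ (m ∸ n) ≡ m ⊓ n
    m∸[m∸n]≡m⊓n m n with ≤-total n m
    ... | inj₁ n≤m = trans (m∸[m∸n]≡n n≤m) (sym (m≥n⇒m⊓n≡n n≤m))
    ... | inj₂ m≤n = trans (cong (m ∸_) (m≤n⇒m∸n≡0 m≤n)) (sym (m≤n⇒m⊓n≡m m≤n))

-- Two calls of the given program

-- The expressions are to yield the numbers of positions from rows 1 and 2, the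
-- pointers to the encodings of the rows, and the place for the second answer.
-- Together with the arguments they are kept in registers that P does not touch.
callTwice : List Expr → Prog → Prog
callTwice xs P =
  compileAll 0 (var 0 ∷ var 1 ∷ var 2 ∷ var 3 ∷ var 4 ∷ var 5 ∷ var 6 ∷ []) M ⨾
  compileAll M xs (7 + M) ⨾
  loadRegs (M ∷ 1 + M ∷ 4 + M ∷ 9 + M ∷ 6 + M ∷ []) 0 ⨾ P ⨾
  loadRegs (M ∷ 1 + M ∷ 4 + M ∷ 10 + M ∷ 11 + M ∷ []) 0 ⨾ P ⨾
  loadRegs (7 + M ∷ 8 + M ∷ []) 0
  where M = 7 + regBound P

-- 19 register copies: 7 to save the arguments, 5 before each of the two calls, and 2 to return the
-- counts.
overhead : List Expr → ℕ
overhead xs = 19 + sum (map time xs)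

module _ {w : ℕ} {P : Prog} (xs : List Expr) {n k b t : ℕ} {β₁ β₂ : BitString}
         {ℓ} {Post₁ Post₂ : ℕ → State w → Set ℓ}
         (call₁ : Computes w P β₁ (n ∷ k ∷ b ∷ []) n t Post₁)
         (call₂ : Computes w P β₂ (n ∷ k ∷ b ∷ []) n t Post₂) where

  private
    -- The summand 7 keeps the saved arguments clear of registers 0 to 6, where they arrive; the
    -- other one makes them and the five computed values after them outlast both calls.
    M = 7 + regBound P

    open Evaluation using (var)

    lit : ∀ i {i<7 : True (i <? 7)} → i + 0 < 7
    lit i {i<7} = subst (_< 7) (sym (+-identityʳ i)) (toWitness i<7)

  -- The second call puts its answer at `o + c` and, by the calling convention, leaves everything
  -- below intact. So the first `c` positions of the first answer survive and the rest may be
  -- overwritten. After the second call only registers change, which is why its output memory is the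
  -- final one.
  callTwice-correct :
    ∀ (rom : Memory w) σ {i j e o c d e₁ e₂} →
    RegsHold σ (n ∷ k ∷ i ∷ j ∷ b ∷ e ∷ o ∷ []) →
    (∀ σ₀ → RegsFrom σ₀ M (n ∷ k ∷ i ∷ j ∷ b ∷ e ∷ o ∷ []) →
      Pointwise (Evaluation._⇝_ rom σ₀ M (7 + M)) xs (c ∷ d ∷ e₁ ∷ e₂ ∷ o + c ∷ [])) →
    StoredAt w rom e₁ β₁ → StoredAt w rom e₂ β₂ → o + c + n ≤ 2 ^ w →
    Σ (State w) λ σ′ → Σ ℕ λ s → (rom ⊢ callTwice xs P , σ ⇓ σ′ [ s ]) × s ≤ 2 * t + overhead xs ×
      (∀ a → toℕ a < o → out σ′ a ≡ out σ a) × RegsHold σ′ (c ∷ d ∷ []) ×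
      Σ (State w) λ σ₁ → Post₁ o σ₁ × (∀ a → toℕ a < o + c → out σ′ a ≡ out σ₁ a) ×
      Σ (State w) λ σ₂ → Post₂ (o + c) σ₂ × out σ′ ≡ out σ₂
  callTwice-correct rom σ {i} {j} {e} {o} {c} {d} {e₁} {e₂} hold eval stored₁ stored₂ room
    with r₀ , r₁ , r₂ , r₃ , r₄ , r₅ , r₆ , tt ← RegsHold⇒RegsFrom {σ = σ}
        (n ∷ k ∷ i ∷ j ∷ b ∷ e ∷ o ∷ []) hold
    with σ₁ , run₁ , args₁ , _ , out₁ ← Evaluation.compileAll-correct rom σ 0 7
           {var 0 ∷ var 1 ∷ var 2 ∷ var 3 ∷ var 4 ∷ var 5 ∷ var 6 ∷ []}
               {n ∷ k ∷ i ∷ j ∷ b ∷ e ∷ o ∷ []}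
           (var (lit 0) r₀ ∷ var (lit 1) r₁ ∷ var (lit 2) r₂ ∷ var (lit 3) r₃ ∷ var (lit 4) r₄
               ∷ var (lit 5) r₅ ∷ var (lit 6) r₆ ∷ [])
           M σ (m≤m+n 7 _ , λ _ _ → refl)
    with σ₂ , run₂ , (vc , vd , v₁ , v₂ , vo , tt) , same₂ ,
        out₂ ← Evaluation.compileAll-correct rom σ₁ M (7 + M)
           (eval σ₁ args₁) (7 + M) σ₁ (≤-refl , λ _ _ → refl)
    with a₀ , a₁ , a₂ , a₃ , a₄ , a₅ , a₆ , tt ← RegsFrom-frame {σ = σ₁} {σ₂} {M}
        (n ∷ k ∷ i ∷ j ∷ b ∷ e ∷ o ∷ [])
           (λ r _ r< → same₂ r (subst (r <_) (+-comm M 7) r<)) args₁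
    with σ₃ , run₃ , params₃ , same₃ , out₃ ← loadRegs-correct {rom = rom} {M}
        (M ∷ 1 + M ∷ 4 + M ∷ 9 + M ∷ 6 + M ∷ [])
           (n ∷ k ∷ b ∷ e₁ ∷ o ∷ []) 0 σ₂ (m≤m+n 5 _)
           ((m≤n+m M 0 , a₀) ∷ (m≤n+m M 1 , a₁) ∷ (m≤n+m M 4 , a₄) ∷ (m≤n+m M 9 , v₁)
               ∷ (m≤n+m M 6 , a₆) ∷ [])
    with σ₄ , s₁ , run₄ , s₁≤ , below₁ , post₁ ← call₁ rom σ₃ e₁ o stored₁
           (≤-trans (+-monoˡ-≤ n (m≤m+n o c)) room) (RegsFrom⇒RegsHold {σ = σ₃}
               (n ∷ k ∷ b ∷ e₁ ∷ o ∷ []) params₃)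
    with b₀ , b₁ , _ , _ , b₄ , _ , _ , bc , bd , _ , b₂ , bo , tt ←
           RegsFrom-frame {σ = σ₂} {σ₄} {M} (n ∷ k ∷ i ∷ j ∷ b ∷ e ∷ o ∷ c ∷ d ∷ e₁ ∷ e₂
               ∷ o + c ∷ [])
             (λ r M≤r _ → trans (frame (≤-trans (m≤n+m _ 7) M≤r) run₄) (same₃ r (inj₂ M≤r)))
             (a₀ , a₁ , a₂ , a₃ , a₄ , a₅ , a₆ , vc , vd , v₁ , v₂ , vo , tt)
    with σ₅ , run₅ , params₅ , same₅ , out₅ ← loadRegs-correct {rom = rom} {M}
        (M ∷ 1 + M ∷ 4 + M ∷ 10 + M ∷ 11 + M ∷ [])
           (n ∷ k ∷ b ∷ e₂ ∷ o + c ∷ []) 0 σ₄ (m≤m+n 5 _)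
           ((m≤n+m M 0 , b₀) ∷ (m≤n+m M 1 , b₁) ∷ (m≤n+m M 4 , b₄) ∷ (m≤n+m M 10 , b₂)
               ∷ (m≤n+m M 11 , bo) ∷ [])
    with σ₆ , s₂ , run₆ , s₂≤ , below₂ , post₂ ← call₂ rom σ₅ e₂ (o + c) stored₂
           room (RegsFrom⇒RegsHold {σ = σ₅} (n ∷ k ∷ b ∷ e₂ ∷ o + c ∷ []) params₅)
    with c₀ , c₁ , tt ← RegsFrom-frame {σ = σ₄} {σ₆} {7 + M} (c ∷ d ∷ [])
           (λ r M≤r _ → let M≤r′ = ≤-trans (m≤n+m M 7) M≤r in
             trans (frame (≤-trans (m≤n+m _ 7) M≤r′) run₆) (same₅ r (inj₂ M≤r′)))
           (bc , bd , tt)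
    with σ₇ , run₇ , params₇ , _ , out₇ ← loadRegs-correct {rom = rom} {M} (7 + M ∷ 8 + M ∷ [])
           (c ∷ d ∷ []) 0 σ₆ (m≤m+n 2 _) ((m≤n+m M 7 , c₀) ∷ (m≤n+m M 8 , c₁) ∷ [])
    = σ₇ , _ , ⇓seq run₁ (⇓seq run₂ (⇓seq run₃ (⇓seq run₄ (⇓seq run₅ (⇓seq run₆ run₇)))))
    , steps s₁≤ s₂≤
    , (λ a a<o → trans (cong-app out₇ a) (trans (below₂ a (≤-trans a<o (m≤m+n o c)))
        (trans (cong-app out₅ a) (trans (below₁ a a<o) (cong-app
            (trans out₃ (trans out₂ out₁)) a)))))
    , RegsFrom⇒RegsHold {σ = σ₇} (c ∷ d ∷ []) params₇
    , σ₄ , post₁ , (λ a a< → trans (cong-app out₇ a) (trans (below₂ a a<) (cong-app out₅ a)))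
    , σ₆ , post₂ , out₇
    where
    steps : ∀ {s₁ s₂} → s₁ ≤ t → s₂ ≤ t →
            7 + (sum (map time xs) + (5 + (s₁ + (5 + (s₂ + 2))))) ≤ 2 * t + overhead xs
    steps {s₁} {s₂} s₁≤ s₂≤ = begin
      7 + (X + (5 + (s₁ + (5 + (s₂ + 2)))))  ≡⟨ arrange X s₁ s₂ ⟩
      s₁ + s₂ + (19 + X)                     ≤⟨ +-monoˡ-≤ (19 + X) (+-mono-≤ s₁≤ s₂≤) ⟩
      t + t + (19 + X)                       ≡⟨ cong (λ x → t + x + (19 + X)) (+-identityʳ t) ⟨
      2 * t + (19 + X)                       ∎
      where
      open ≤-Reasoning
      X = sum (map time xs)
      arrange : ∀ X s₁ s₂ → 7 + (X + (5 + (s₁ + (5 + (s₂ + 2))))) ≡ s₁ + s₂ + (19 + X)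
      arrange = solve-∀

-- The query program and the layout of the encoding

-- Variables 0, …, 6 are the arguments n, k, i, j, b and the pointers e and o.
-- Cells 0, …, 5 of the header contain the offsets of the parts of the encoding,
-- and cells 6, 7, 8 contain u, z and 3 ^ τ.
headerᵉ : ℕ → Expr
headerᵉ t = mem (bin add (var 5) (con t))

tableᵉ : ℕ → Expr → Expr
tableᵉ t x = mem (bin add (bin add (var 5) (headerᵉ t)) x)

-- The number of pieces is fixed in the program, so the sum unrolls into straight-line code.
digitSumᵉ : ℕ → Expr → Expr
digitSumᵉ zero    y = con 0
digitSumᵉ (suc g) y = bin add (tableᵉ 2 (bin mod y (headerᵉ 8)))
    (digitSumᵉ g (bin div y (headerᵉ 8)))

prefixSumᵉ : ℕ → Expr → Expr
prefixSumᵉ g s =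
  bin add (bin add (tableᵉ 1 (bin div j (headerᵉ 7))) (bin div (tableᵉ 0 j) (tableᵉ 3 (headerᵉ 6))))
          (digitSumᵉ g (bin mod (tableᵉ 0 j) (tableᵉ 3 (bin mod s (headerᵉ 6)))))
  where j = bin div s (headerᵉ 6)

topCountᵉ : ℕ → Expr
topCountᵉ g = monus (var 4) (monus (bin mul (con 2) s) (prefixSumᵉ g s))
  where s = monus (var 4) (bin div (var 1) (con 2))

count₁ᵉ count₂ᵉ : ℕ → Expr
count₁ᵉ g = bin mul (bin lt (var 2) (con 2))
              (bin add (bin mul (bin lt (var 3) (con 2)) (min (var 1) (var 4)))
                       (bin mul (bin lt (con 1) (var 3)) (topCountᵉ g)))
count₂ᵉ g = monus (min (var 1) (bin add (bin mul (monus (var 3) (var 2)) (var 4)) (var 4)))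
    (count₁ᵉ g)

queryᵉ : ℕ → List Expr
queryᵉ g = count₁ᵉ g ∷ count₂ᵉ g ∷ bin add (var 5) (headerᵉ 4) ∷ bin add (var 5) (headerᵉ 5) ∷
           bin add (var 6) (count₁ᵉ g) ∷ []

module Layout (w : ℕ) {{_ : NonZero w}} (f : ℕ → ℕ)
              (m u z τ : ℕ) {{_ : NonZero u}} {{_ : NonZero z}} (β₁ β₂ : BitString) where

  -- A query may ask for the sum of all `m` trits, so word `m / u` and its group must exist even if
  -- no trit of the array is left for them; exponents likewise run up to `u` itself.
  trits sums digits powers : List ℕ
  trits  = applyUpTo (tritWord f u z) (suc (m / u))
  sums   = applyUpTo (λ q → prefixSum f (q * z * u)) (suc (m / u / z))
  digits = applyUpTo (digitSum τ) (3 ^ τ)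
  powers = applyUpTo (3 ^_) (suc u)

  at₁ at₂ at₃ at₄ at₅ at₆ : ℕ
  at₁ = 9 + length trits
  at₂ = at₁ + length sums
  at₃ = at₂ + length digits
  at₄ = at₃ + length powers
  at₅ = at₄ + length (chunks w β₁)
  at₆ = at₅ + length (chunks w β₂)

  -- The final word ensures that all parts start within the address space.
  contents : List ℕ
  contents = (9 ∷ at₁ ∷ at₂ ∷ at₃ ∷ at₄ ∷ at₅ ∷ u ∷ z ∷ 3 ^ τ ∷ []) ++
             trits ++ sums ++ digits ++ powers ++ chunks w β₁ ++ chunks w β₂ ++ 0 ∷ []

  module Stored (rom : Memory w) (e : ℕ) (stored : StoredAt w rom e (serialise w contents)) where

    Segment-++′ : ∀ x us {vs} → Segment w rom (e + x) (us ++ vs) →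
                  Segment w rom (e + x) us × Segment w rom (e + (x + length us)) vs
    Segment-++′ x us {vs} s with s₁ , s₂ ← Segment-++ w us s =
      s₁ , subst (λ y → Segment w rom y vs) (+-assoc e x (length us)) s₂

    record Parts : Set where
      field
        trits-at   : Segment w rom (e + 9) trits
        sums-at    : Segment w rom (e + at₁) sums
        digits-at  : Segment w rom (e + at₂) digits
        powers-at  : Segment w rom (e + at₃) powers
        β₁-at      : StoredAt w rom (e + at₄) β₁
        β₂-at      : StoredAt w rom (e + at₅) β₂
        end        : e + at₆ < 2 ^ w
        header     : Segment w rom e (9 ∷ at₁ ∷ at₂ ∷ at₃ ∷ at₄ ∷ at₅ ∷ u ∷ z ∷ 3 ^ τ ∷ [])

    parts : Parts
    parts =
      let
        h , s₀ = Segment-++ w (9 ∷ at₁ ∷ at₂ ∷ at₃ ∷ at₄ ∷ at₅ ∷ u ∷ z ∷ 3 ^ τ ∷ [])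
            (StoredAt⇒Segment w e contents stored)
        p₁ , s₁ = Segment-++′ 9 trits s₀
        p₂ , s₂ = Segment-++′ at₁ sums s₁
        p₃ , s₃ = Segment-++′ at₂ digits s₂
        p₄ , s₄ = Segment-++′ at₃ powers s₃
        p₅ , s₅ = Segment-++′ at₄ (chunks w β₁) s₄
        p₆ , s₆ = Segment-++′ at₅ (chunks w β₂) s₅
      in record
      { trits-at = p₁ ; sums-at = p₂ ; digits-at = p₃ ; powers-at = p₄
      ; β₁-at = Segment-chunks w β₁ p₅ ; β₂-at = Segment-chunks w β₂ p₆
      ; end = proj₁ (Cell-< {w} {rom} (proj₁ s₆)) ; header = h }
    open Parts parts public

    module Query (f≤2 : ∀ i → f i ≤ 2) (3^u< : 3 ^ u < 2 ^ w) (z< : z < 2 ^ w) (τ≤u : τ ≤ u)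
             (trits< : ∀ j → tritWord f u z j < 2 ^ w) (m< : m * 2 < 2 ^ w) where

      3^τ< : 3 ^ τ < 2 ^ w
      3^τ< = ≤-<-trans (^-monoʳ-≤ 3 τ≤u) 3^u<

      u< : u < 2 ^ w
      u< = ≤-<-trans (n≤3^n u) 3^u<
        where
        n≤3^n : ∀ n → n ≤ 3 ^ n
        n≤3^n zero    = z≤n
        n≤3^n (suc n) = ≤-trans (+-mono-≤ (m^n>0 3 n) (n≤3^n n))
            (+-monoʳ-≤ (3 ^ n) (m≤m+n (3 ^ n) _))

      HeaderCells : Set
      HeaderCells = Cell w rom (e + 0) 9 × Cell w rom (e + 1) at₁ × Cell w rom (e + 2) at₂ ×
                    Cell w rom (e + 3) at₃ × Cell w rom (e + 4) at₄ × Cell w rom (e + 5) at₅ ×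
                    Cell w rom (e + 6) u × Cell w rom (e + 7) z × Cell w rom (e + 8) (3 ^ τ)

      headerCells : HeaderCells
      headerCells =
        let h₀ , h₁ , h₂ , h₃ , h₄ , h₅ , h₆ , h₇ , h₈ , _ = header in
        cell 0 a₀ h₀ , cell 1 a₁ h₁ , cell 2 a₂ h₂ , cell 3 a₃ h₃ , cell 4 a₄ h₄ , cell 5 a₅ h₅ ,
        cell 6 u< h₆ , cell 7 z< h₇ , cell 8 3^τ< h₈
        where
        cell : ∀ t {v} → v < 2 ^ w → Cell w rom (t + e) (v %2^ w) → Cell w rom (e + t) v
        cell t v< = subst₂ (Cell w rom) (+-comm t e) (<2^⇒%2^ {w = w} v<)

        -- The address of the final word is below `2 ^ w`. It bounds all offsets, which are
        -- therefore stored unreduced.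
        a₅ : at₅ < 2 ^ w
        a₅ = ≤-<-trans (≤-trans (m≤m+n at₅ _) (m≤n+m at₆ e)) end
        a₄ : at₄ < 2 ^ w
        a₄ = ≤-<-trans (m≤m+n at₄ _) a₅
        a₃ : at₃ < 2 ^ w
        a₃ = ≤-<-trans (m≤m+n at₃ _) a₄
        a₂ : at₂ < 2 ^ w
        a₂ = ≤-<-trans (m≤m+n at₂ _) a₃
        a₁ : at₁ < 2 ^ w
        a₁ = ≤-<-trans (m≤m+n at₁ _) a₂
        a₀ : 9 < 2 ^ w
        a₀ = ≤-<-trans (m≤m+n 9 _) a₁

      module Arguments {σ₀ : State w} {M : Reg} {n k i j b o : ℕ}
               (args : RegsFrom σ₀ M (n ∷ k ∷ i ∷ j ∷ b ∷ e ∷ o ∷ [])) where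

        open Evaluation rom σ₀ M (7 + M)

        private
          lit : ∀ i {i<7 : True (i <? 7)} → i + M < 7 + M
          lit i {i<7} = +-monoˡ-< M (toWitness i<7)

          k⇝ : var 1 ⇝ k
          k⇝ = var (lit 1) (proj₁ (proj₂ args))
          i⇝ : var 2 ⇝ i
          i⇝ = var (lit 2) (proj₁ (proj₂ (proj₂ args)))
          j⇝ : var 3 ⇝ j
          j⇝ = var (lit 3) (proj₁ (proj₂ (proj₂ (proj₂ args))))
          b⇝ : var 4 ⇝ b
          b⇝ = var (lit 4) (proj₁ (proj₂ (proj₂ (proj₂ (proj₂ args)))))
          e⇝ : var 5 ⇝ e
          e⇝ = var (lit 5) (proj₁ (proj₂ (proj₂ (proj₂ (proj₂ (proj₂ args))))))
          o⇝ : var 6 ⇝ o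
          o⇝ = var (lit 6) (proj₁ (proj₂ (proj₂ (proj₂ (proj₂ (proj₂ (proj₂ args)))))))

          header⇝ : ∀ t {v} → Cell w rom (e + t) v → headerᵉ t ⇝ v
          header⇝ t c = mem (add⇝ e⇝ (con (≤-<-trans (m≤n+m t e) e+t<)) e+t<) c
            where e+t< = proj₁ (Cell-< {w} {rom} c)

          table⇝ : ∀ t {x v y a} → Cell w rom (e + t) x → y ⇝ a → Cell w rom (e + x + a) v →
              tableᵉ t y ⇝ v
          table⇝ t {x} {a = a} h y⇝ c =
              mem (add⇝ (add⇝ e⇝ (header⇝ t h) (≤-<-trans (m≤m+n (e + x) a) addr<)) y⇝ addr<) c
            where addr< = proj₁ (Cell-< {w} {rom} c)

          h₀ = proj₁ headerCells
          h₁ = proj₁ (proj₂ headerCells)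
          h₂ = proj₁ (proj₂ (proj₂ headerCells))
          h₃ = proj₁ (proj₂ (proj₂ (proj₂ headerCells)))
          h₄ = proj₁ (proj₂ (proj₂ (proj₂ (proj₂ headerCells))))
          h₅ = proj₁ (proj₂ (proj₂ (proj₂ (proj₂ (proj₂ headerCells)))))
          h₆ = proj₁ (proj₂ (proj₂ (proj₂ (proj₂ (proj₂ (proj₂ headerCells))))))
          h₇ = proj₁ (proj₂ (proj₂ (proj₂ (proj₂ (proj₂ (proj₂ (proj₂ headerCells)))))))
          h₈ = proj₂ (proj₂ (proj₂ (proj₂ (proj₂ (proj₂ (proj₂ (proj₂ headerCells)))))))

        digitSum⇝ : ∀ g {y a} → y ⇝ a → blockSum τ g a < 2 ^ w → digitSumᵉ g y ⇝ blockSum τ g a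
        digitSum⇝ zero    _           0<   = con 0<
        digitSum⇝ (suc g) {a = a} y⇝ sum< =
          add⇝ (table⇝ 2 h₂ (mod⇝ y⇝ (header⇝ 8 h₈) {{m^n≢0 3 τ}})
                  (Segment-applyUpTo w (digitSum τ) digits-at (m%n<n a (3 ^ τ) {{m^n≢0 3 τ}})
                    (≤-<-trans (m≤m+n _ _) sum<)))
               (digitSum⇝ g (div⇝ y⇝ (header⇝ 8 h₈) {{m^n≢0 3 τ}}) (≤-<-trans (m≤n+m _ _) sum<))
               sum<

        -- All partial results are bounded by the final sum, at most twice `m`, so no addition
        -- overflows.
        prefixSum⇝ : ∀ {g y s} → u ≤ g * τ → s ≤ m → y ⇝ s → prefixSumᵉ g y ⇝ prefixSum f s
        prefixSum⇝ {g} {y} {s} u≤gτ s≤m y⇝ =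
          subst (prefixSumᵉ g y ⇝_) value
            (add⇝ (add⇝ sum⇝ (div⇝ word⇝ (power⇝ (header⇝ 6 h₆) ≤-refl) {{m^n≢0 3 u}}) left<)
                  (digitSum⇝ g (mod⇝ word⇝ (power⇝ (mod⇝ y⇝ (header⇝ 6 h₆)) (<⇒≤ (m%n<n s u)))
                      {{m^n≢0 3 (s % u)}}) right<)
                  (subst (_< 2 ^ w) (sym value) (bounded s≤m)))
          where
          block : ℕ
          block = s / u

          block≤ : block ≤ m / u
          block≤ = /-monoˡ-≤ u s≤m

          bounded : ∀ {t} → t ≤ m → prefixSum f t < 2 ^ w
          bounded {t} t≤m = ≤-<-trans (≤-trans (prefixSum-≤ f≤2 t) (*-monoˡ-≤ 2 t≤m)) m<

          start≤ : groupStart f u z block ≤ m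
          start≤ = ≤-trans (*-monoˡ-≤ u (m/n*n≤m block z)) (≤-trans (m/n*n≤m s u) s≤m)

          left  = groupSum + tritWord f u z block /3^ u
            where groupSum = prefixSum f (groupStart f u z block)
          right = tritWord f u z block %3^ (s % u)

          value : left + blockSum τ g right ≡ prefixSum f s
          value = trans (cong (left +_) (blockSum≡digitSum τ g right))
              (prefixSum-query f u z f≤2 s u≤gτ)

          left< : left < 2 ^ w
          left< = ≤-<-trans (≤-trans (m≤m+n left _) (≤-reflexive value)) (bounded s≤m)

          right< : blockSum τ g right < 2 ^ w
          right< = ≤-<-trans (≤-trans (m≤n+m _ left) (≤-reflexive value)) (bounded s≤m)

          block⇝ : bin div y (headerᵉ 6) ⇝ block
          block⇝ = div⇝ y⇝ (header⇝ 6 h₆)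

          word⇝ : tableᵉ 0 (bin div y (headerᵉ 6)) ⇝ tritWord f u z block
          word⇝ = table⇝ 0 h₀ block⇝ (Segment-applyUpTo w (tritWord f u z) trits-at (s≤s block≤)
              (trits< block))

          sum⇝ : tableᵉ 1 (bin div (bin div y (headerᵉ 6)) (headerᵉ 7)) ⇝ prefixSum f
              (groupStart f u z block)
          sum⇝ = table⇝ 1 h₁ (div⇝ block⇝ (header⇝ 7 h₇))
            (Segment-applyUpTo w (λ q → prefixSum f (q * z * u)) sums-at (s≤s (/-monoˡ-≤ z block≤))
                (bounded start≤))

          power⇝ : ∀ {x p} → x ⇝ p → p ≤ u → tableᵉ 3 x ⇝ 3 ^ p
          power⇝ x⇝ p≤u = table⇝ 3 h₃ x⇝
            (Segment-applyUpTo w (3 ^_) powers-at (s≤s p≤u) (≤-<-trans (^-monoʳ-≤ 3 p≤u) 3^u<))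

        topCount⇝ : ∀ {g} → u ≤ g * τ → 2 < 2 ^ w → 2 * (b ∸ k / 2) < 2 ^ w → b ∸ k / 2 ≤ m →
                    topCountᵉ g ⇝ b ∸ (2 * (b ∸ k / 2) ∸ prefixSum f (b ∸ k / 2))
        topCount⇝ u≤gτ 2< 2s< s≤m =
          monus⇝ b⇝ (monus⇝ (mul⇝ (con 2<) s⇝ 2s<) (prefixSum⇝ u≤gτ s≤m s⇝))
          where s⇝ = monus⇝ b⇝ (div⇝ k⇝ (con 2<))

        module _ {g K} (K⇝ : topCountᵉ g ⇝ K) (K≤b : K ≤ b) (2< : 2 < 2 ^ w) where

          private
            b< = ⇝-< b⇝

          count₁⇝ : count₁ᵉ g ⇝ count₁ k i j b K
          count₁⇝ =
            mul⇝ (lt⇝ i⇝ (con 2<))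
              (add⇝ (mul⇝ (lt⇝ j⇝ (con 2<)) min⇝′ (≤-<-trans (lt*-≤ j 2 _)
                  (≤-<-trans (m⊓n≤n k b) b<)))
                    (mul⇝ (lt⇝ (con (<⇒≤ 2<)) j⇝) K⇝ (≤-<-trans (lt*-≤ 1 j K) (⇝-< K⇝)))
                    (≤-<-trans (oneOf-≤ j (m⊓n≤n k b) K≤b) b<))
              (≤-<-trans (count₁-≤ k i j K≤b) b<)
            where min⇝′ = min⇝ k⇝ b⇝

          query⇝ : (j ∸ i) * b + b < 2 ^ w → o + count₁ k i j b K < 2 ^ w →
                   Pointwise _⇝_ (queryᵉ g)
                     (count₁ k i j b K ∷ count₂ k i j b K ∷ e + at₄ ∷ e + at₅ ∷ o
                         + count₁ k i j b K ∷ [])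
          query⇝ total< o< =
            count₁⇝ ∷
            monus⇝ (min⇝ k⇝ (add⇝ (mul⇝ (monus⇝ j⇝ i⇝) b⇝ (≤-<-trans (m≤m+n _ b) total<)) b⇝
                total<)) count₁⇝ ∷
            add⇝ e⇝ (header⇝ 4 h₄) (≤-<-trans
                (+-monoʳ-≤ e (≤-trans (m≤m+n at₄ _) (m≤m+n at₅ _))) end) ∷
            add⇝ e⇝ (header⇝ 5 h₅) (≤-<-trans (+-monoʳ-≤ e (m≤m+n at₅ _)) end) ∷
            add⇝ o⇝ count₁⇝ o< ∷ []

  length-contents : length contents ≡ 9
      + (suc (m / u) + (suc (m / u / z)
      + (3 ^ τ + (suc u + (length (chunks w β₁) + (length (chunks w β₂) + 1))))))
  length-contents =
    trans (cong (9 +_) (trans (length-++ trits) (cong (length trits +_)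
        (trans (length-++ sums) (cong (length sums +_)
      (trans (length-++ digits) (cong (length digits +_) (trans (length-++ powers)
          (cong (length powers +_)
      (trans (length-++ (chunks w β₁)) (cong (length (chunks w β₁) +_)
          (length-++ (chunks w β₂)))))))))))))
    (cong (9 +_) (cong₂ _+_ (length-applyUpTo (tritWord f u z) (suc (m / u)))
      (cong₂ _+_ (length-applyUpTo (λ q → prefixSum f (q * z * u)) (suc (m / u / z)))
      (cong₂ _+_ (length-applyUpTo (digitSum τ) (3 ^ τ))
        (cong (_+ (length (chunks w β₁) + (length (chunks w β₂) + 1)))
            (length-applyUpTo (3 ^_) (suc u)))))))

-- Asymptotics and the choice of the parameters

module _ where

  open ≤-Reasoning

  2⌊n/2⌋≤n : ∀ n → 2 * ⌊ n /2⌋ ≤ n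
  2⌊n/2⌋≤n n = begin
    2 * ⌊ n /2⌋          ≡⟨ cong (⌊ n /2⌋ +_) (+-identityʳ ⌊ n /2⌋) ⟩
    ⌊ n /2⌋ + ⌊ n /2⌋    ≤⟨ +-monoʳ-≤ ⌊ n /2⌋ (⌊n/2⌋≤⌈n/2⌉ n) ⟩
    ⌊ n /2⌋ + ⌈ n /2⌉    ≡⟨ ⌊n/2⌋+⌈n/2⌉≡n n ⟩
    n                    ∎

  2^⌊log₂n⌋≤n : ∀ n → 1 ≤ n → 2 ^ ⌊log₂ n ⌋ ≤ n
  2^⌊log₂n⌋≤n = <-rec (λ n → 1 ≤ n → 2 ^ ⌊log₂ n ⌋ ≤ n) step
    where
    step : ∀ n → (∀ {m} → m < n → 1 ≤ m → 2 ^ ⌊log₂ m ⌋ ≤ m) → 1 ≤ n → 2 ^ ⌊log₂ n ⌋ ≤ n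
    step 1                 rec _ = ≤-reflexive (cong (2 ^_) (⌊log₂[2^n]⌋≡n 0))
    step n@(suc (suc n-2)) rec _ = begin
      2 ^ ⌊log₂ n ⌋                ≤⟨ ^-monoʳ-≤ 2 (m≤n+m∸n ⌊log₂ n ⌋ 1) ⟩
      2 * 2 ^ (⌊log₂ n ⌋ ∸ 1)      ≡⟨ cong (λ l → 2 * 2 ^ l) (⌊log₂⌊n/2⌋⌋≡⌊log₂n⌋∸1 n) ⟨
      2 * 2 ^ ⌊log₂ ⌊ n /2⌋ ⌋      ≤⟨ *-monoʳ-≤ 2 (rec (⌊n/2⌋<n (suc n-2)) (s≤s z≤n)) ⟩
      2 * ⌊ n /2⌋                  ≤⟨ 2⌊n/2⌋≤n n ⟩
      n                            ∎

  n<2^[1+⌊log₂n⌋] : ∀ n → n < 2 ^ suc ⌊log₂ n ⌋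
  n<2^[1+⌊log₂n⌋] n = ≰⇒> λ le → n≮n ⌊log₂ n ⌋ (begin
    suc ⌊log₂ n ⌋                  ≡⟨ ⌊log₂[2^n]⌋≡n (suc ⌊log₂ n ⌋) ⟨
    ⌊log₂ (2 ^ suc ⌊log₂ n ⌋) ⌋    ≤⟨ ⌊log₂⌋-mono-≤ le ⟩
    ⌊log₂ n ⌋                      ∎)

  2^l≤n⇒l≤⌊log₂n⌋ : ∀ {l n} → 2 ^ l ≤ n → l ≤ ⌊log₂ n ⌋
  2^l≤n⇒l≤⌊log₂n⌋ {l} le = ≤-trans (≤-reflexive (sym (⌊log₂[2^n]⌋≡n l))) (⌊log₂⌋-mono-≤ le)

  n<2^n : ∀ n → n < 2 ^ n
  n<2^n zero    = s≤s z≤n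
  n<2^n (suc n) = +-mono-≤ (m^n>0 2 n) (≤-trans (n<2^n n) (≤-reflexive (sym (+-identityʳ _))))

  ^-cancel-< : ∀ m .{{_ : NonZero m}} {i j} → m ^ i < m ^ j → i < j
  ^-cancel-< m {i} {j} m^i<m^j = ≰⇒> λ j≤i → contradiction m^i<m^j (≤⇒≯ (^-monoʳ-≤ m j≤i))

  -- Cubing l ≤ 3 * 2 ^ (l / 3) gives l³ ≤ 27 * 2 ^ l, and for l > 27c the third factor l absorbs
  -- the constant.
  square≤2^ : ∀ c → ∃ λ L → ∀ l → L ≤ l → c * (l * l) ≤ 2 ^ l
  square≤2^ c = suc (27 * c) , λ l L≤l →
    *-cancelˡ-≤ l {{>-nonZero (≤-trans (s≤s z≤n) L≤l)}} (begin
      l * (c * (l * l))                                 ≡⟨ arrange l c ⟩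
      c * (l * l * l)
        ≤⟨ *-monoʳ-≤ c (*-mono-≤ (*-mono-≤ (third l) (third l)) (third l)) ⟩
      c * (3 * 2 ^ (l / 3) * (3 * 2 ^ (l / 3)) * (3 * 2 ^ (l / 3)))   ≡⟨ arrange′ c (2 ^ (l / 3)) ⟩
      27 * c * (2 ^ (l / 3)) ^ 3
        ≡⟨ cong (27 * c *_) (^-*-assoc 2 (l / 3) 3) ⟩
      27 * c * 2 ^ (l / 3 * 3)
        ≤⟨ *-mono-≤ (<⇒≤ L≤l) (^-monoʳ-≤ 2 (m/n*n≤m l 3)) ⟩
      l * 2 ^ l                                         ∎)
    where
    arrange : ∀ l c → l * (c * (l * l)) ≡ c * (l * l * l)
    arrange = solve-∀
    arrange′ : ∀ c x → c * (3 * x * (3 * x) * (3 * x)) ≡ 27 * c * (x * (x * (x * 1)))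
    arrange′ = solve-∀

    third : ∀ l → l ≤ 3 * 2 ^ (l / 3)
    third l = begin
      l                    ≡⟨ m≡m%n+[m/n]*n l 3 ⟩
      l % 3 + l / 3 * 3    ≤⟨ +-monoˡ-≤ (l / 3 * 3) (<⇒≤ (m%n<n l 3)) ⟩
      3 + l / 3 * 3        ≡⟨ *-comm (suc (l / 3)) 3 ⟩
      3 * suc (l / 3)      ≤⟨ *-monoʳ-≤ 3 (n<2^n (l / 3)) ⟩
      3 * 2 ^ (l / 3)      ∎

  log≤ : ∀ c → ∃ λ N → ∀ n → N ≤ n → c * (2 + ⌊log₂ n ⌋) ≤ n
  log≤ c = 2 ^ (2 + L) , bound
    where
    L = proj₁ (square≤2^ (2 * c))

    bound : ∀ n → 2 ^ (2 + L) ≤ n → c * (2 + ⌊log₂ n ⌋) ≤ n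
    bound n N≤n = begin
      c * (2 + l)         ≤⟨ *-monoʳ-≤ c (+-mono-≤ 2≤l (≤-reflexive (sym (+-identityʳ l)))) ⟩
      c * (2 * l)
        ≤⟨ *-monoʳ-≤ c (*-monoʳ-≤ 2 (m≤m*n l l {{>-nonZero (≤-trans (s≤s z≤n) 2≤l)}})) ⟩
      c * (2 * (l * l))   ≡⟨ trans (sym (*-assoc c 2 (l * l))) (cong (_* (l * l)) (*-comm c 2)) ⟩
      2 * c * (l * l)     ≤⟨ proj₂ (square≤2^ (2 * c)) l (≤-trans (m≤n+m L 2) L≤l) ⟩
      2 ^ l               ≤⟨ 2^⌊log₂n⌋≤n n (≤-trans (m^n>0 2 (2 + L)) N≤n) ⟩
      n                   ∎
      where
      l = ⌊log₂ n ⌋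

      L≤l : 2 + L ≤ l
      L≤l = 2^l≤n⇒l≤⌊log₂n⌋ N≤n

      2≤l : 2 ≤ l
      2≤l = ≤-trans (m≤m+n 2 L) L≤l

  IsLittleO-+ : ∀ {r s} → IsLittleO-n r → IsLittleO-n s → IsLittleO-n (λ n → r n + s n)
  IsLittleO-+ {r} {s} r-o s-o c with N , rN ← r-o (2 * c) | N′ , sN ← s-o (2 * c) =
      N ⊔ N′ , λ n N≤n →
    *-cancelˡ-≤ 2 (begin
      2 * (c * (r n + s n))          ≡⟨ arrange c (r n) (s n) ⟩
      2 * c * r n + 2 * c * s n
        ≤⟨ +-mono-≤ (rN n (m⊔n≤o⇒m≤o N N′ N≤n)) (sN n (m⊔n≤o⇒n≤o N N′ N≤n)) ⟩
      n + n                          ≡⟨ cong (n +_) (+-identityʳ n) ⟨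
      2 * n                          ∎)
    where
    arrange : ∀ c r s → 2 * (c * (r + s)) ≡ 2 * c * r + 2 * c * s
    arrange = solve-∀

  IsLittleO-≤ : ∀ {r s} N → (∀ n → N ≤ n → r n ≤ s n) → IsLittleO-n s → IsLittleO-n r
  IsLittleO-≤ M r≤s s-o c with N , sN ← s-o c = M ⊔ N , λ n N≤n →
    ≤-trans (*-monoʳ-≤ c (r≤s n (m⊔n≤o⇒m≤o M N N≤n))) (sN n (m⊔n≤o⇒n≤o M N N≤n))

  -- For w ≥ 1, the greatest t with 3 ^ t < 2 ^ w. One more bit makes room for at most one more
  -- trit, so a single trial per bit suffices.
  tritsPerWord : ℕ → ℕ
  tritsPerWord zero    = 0
  tritsPerWord (suc w) with 3 ^ suc (tritsPerWord w) <? 2 ^ suc w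
  ... | yes _ = suc (tritsPerWord w)
  ... | no  _ = tritsPerWord w

  2^w≤3^[1+trits] : ∀ w → 2 ^ w ≤ 3 ^ suc (tritsPerWord w)
  2^w≤3^[1+trits] zero    = s≤s z≤n
  2^w≤3^[1+trits] (suc w) with 3 ^ suc (tritsPerWord w) <? 2 ^ suc w
  ... | no  overflow = ≮⇒≥ overflow
  ... | yes _ = *-mono-≤ {2} {3} (s≤s (s≤s z≤n)) (2^w≤3^[1+trits] w)

  3^trits≤2^w : ∀ w → 3 ^ tritsPerWord w ≤ 2 ^ w
  3^trits<2^w : ∀ w → 3 ^ tritsPerWord (suc w) < 2 ^ suc w
  3^trits≤2^w zero    = ≤-refl
  3^trits≤2^w (suc w) = <⇒≤ (3^trits<2^w w)
  3^trits<2^w w with 3 ^ suc (tritsPerWord w) <? 2 ^ suc w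
  ... | yes fits = fits
  ... | no  _ = ≤-<-trans (3^trits≤2^w w) (^-monoʳ-< 2 (s≤s (s≤s z≤n)) (n<1+n w))

  -- A trit takes less than two bits, as 3 < 4; so the capacity in trits is linear in `w`.
  w≤2+2*trits : ∀ w → w ≤ 2 * suc (tritsPerWord w)
  w≤2+2*trits w = s≤s⁻¹ (^-cancel-< 2 (begin-strict
    2 ^ w                                   ≤⟨ 2^w≤3^[1+trits] w ⟩
    3 ^ suc t                               ≤⟨ ^-monoˡ-≤ (suc t) (n≤1+n 3) ⟩
    4 ^ suc t                               ≡⟨ ^-*-assoc 2 2 (suc t) ⟩
    2 ^ (2 * suc t)                         <⟨ ^-monoʳ-< 2 (s≤s (s≤s z≤n)) (n<1+n (2 * suc t)) ⟩
    2 ^ suc (2 * suc t)                     ∎))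
    where t = tritsPerWord w

  trits≤w : ∀ w → tritsPerWord w ≤ w
  trits≤w w = s≤s⁻¹ (^-cancel-< 2 (begin-strict
    2 ^ t          ≤⟨ ^-monoˡ-≤ t (n≤1+n 2) ⟩
    3 ^ t          ≤⟨ 3^trits≤2^w w ⟩
    2 ^ w          <⟨ ^-monoʳ-< 2 (s≤s (s≤s z≤n)) (n<1+n w) ⟩
    2 ^ suc w      ∎))
    where t = tritsPerWord w

  -- A word holds u trits and a sum in v trits; z words form a group.
  record Parameters (w : ℕ) : Set where
    field
      u v z   : ℕ
      1≤u     : 1 ≤ u
      1≤z     : 1 ≤ z
      dense   : 2 ^ w ≤ 3 ^ suc (u + v)
      fits    : 2 ≤ w → 3 ^ (u + v) < 2 ^ w
      small   : (z ∸ 1) * u * 2 < 3 ^ v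
      z<      : 2 ≤ w → z < 2 ^ w

    instance
      u≢0 : NonZero u
      u≢0 = >-nonZero 1≤u
      z≢0 : NonZero z
      z≢0 = >-nonZero 1≤z

  -- The sums within a group of w words are below 2 w².
  sumTrits : ℕ → ℕ
  sumTrits w = 3 + 2 * ⌊log₂ w ⌋

  parameters : ∀ w → Parameters w
  parameters w with sumTrits w <? tritsPerWord w
  ... | yes v<t = record
    -- Here `z` is `w`, in a form that is visibly positive.
    { u = t ∸ v ; v = v ; z = suc (w ∸ 1)
    ; 1≤u   = m<n⇒0<n∸m v<t ; 1≤z = s≤s z≤n
    ; dense = subst (λ i → 2 ^ w ≤ 3 ^ suc i) (sym u+v≡t) (2^w≤3^[1+trits] w)
    ; fits  = λ { (s≤s (s≤s {n = w-2} _)) → subst (λ i → 3 ^ i < 2 ^ w) (sym u+v≡t)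
        (3^trits<2^w (suc w-2)) }
    ; small = begin-strict
        (w ∸ 1) * (t ∸ v) * 2
          ≤⟨ *-monoˡ-≤ 2 (*-mono-≤ (m∸n≤m w 1) (≤-trans (m∸n≤m t v) (trits≤w w))) ⟩
        -- From w < 2 ^ (l + 1) follows 2w² < 2 ^ (2l + 3), which is where the size of `sumTrits`
        -- comes from.
        w * w * 2
          <⟨ *-monoˡ-< 2 (*-mono-< (n<2^[1+⌊log₂n⌋] w) (n<2^[1+⌊log₂n⌋] w)) ⟩
        2 ^ suc l * 2 ^ suc l * 2                       ≡⟨ arrange (2 ^ l) ⟩
        8 * (2 ^ l) ^ 2
          ≡⟨ cong (8 *_) (trans (^-*-assoc 2 l 2) (cong (2 ^_) (*-comm l 2))) ⟩
        2 ^ 3 * 2 ^ (2 * l)                             ≡⟨ ^-distribˡ-+-* 2 3 (2 * l) ⟨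
        2 ^ (3 + 2 * l)                                 ≤⟨ ^-monoˡ-≤ (3 + 2 * l) (n≤1+n 2) ⟩
        3 ^ v                                           ∎
    ; z<    = λ { (s≤s (s≤s {n = w-2} _)) → n<2^n w }
    }
    where
    t = tritsPerWord w
    v = sumTrits w
    l = ⌊log₂ w ⌋

    u+v≡t : t ∸ v + v ≡ t
    u+v≡t = m∸n+n≡m (<⇒≤ v<t)

    arrange : ∀ x → 2 * x * (2 * x) * 2 ≡ 8 * (x * (x * 1))
    arrange = solve-∀
  -- Only for small w.  Groups of a single word need no sums.
  ... | no _ = record
    { u = suc (t ∸ 1) ; v = 0 ; z = 1 ; 1≤u = s≤s z≤n ; 1≤z = s≤s z≤n
    ; dense = ≤-trans (2^w≤3^[1+trits] w)
        (^-monoʳ-≤ 3 (s≤s (≤-trans (m≤n+m∸n t 1) (≤-reflexive (sym (+-identityʳ (suc (t ∸ 1))))))))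
    ; fits  = λ { (s≤s (s≤s {n = w-2} _)) → subst (λ i → 3 ^ i < 2 ^ w)
        (sym (trans (+-identityʳ (suc (t ∸ 1))) (m+[n∸m]≡n (t≥1 w-2)))) (3^trits<2^w (suc w-2)) }
    ; small = s≤s z≤n
    ; z<    = λ 2≤w → ≤-<-trans (≤-trans (n≤1+n 1) 2≤w) (n<2^n w)
    }
    where
    t = tritsPerWord w

    t≥1 : ∀ w-2 → 1 ≤ tritsPerWord (2 + w-2)
    t≥1 w-2 = s≤s⁻¹ (^-cancel-< 3 (begin-strict
      3                                   <⟨ ^-monoʳ-≤ 2 {2} {2 + w-2} (s≤s (s≤s z≤n)) ⟩
      2 ^ (2 + w-2)                       ≤⟨ 2^w≤3^[1+trits] (2 + w-2) ⟩
      3 ^ suc (tritsPerWord (2 + w-2))    ∎))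

  -- `u` is linear in `w` and `v` only logarithmic. So the bits lost per word are negligible against
  -- its trits, and so is the word spent per group against the trits of the group.
  parameters-asymptotics : ∀ c → ∃ λ N → ∀ w → N ≤ w → let open Parameters (parameters w) in
                           c * (2 * suc v) ≤ u × c * w ≤ u * z
  parameters-asymptotics c = N , bounds
    where
    -- With v + 1 = 2(2 + l), the bound on u asks for t ≥ (4c + 2)(2 + l). As t + 1 ≥ w / 2, it
    -- suffices that w is at least twice (4c + 2)(2 + l) + (2 + l).
    N = proj₁ (log≤ (8 * c + 6))

    bounds : ∀ w → N ≤ w → let open Parameters (parameters w) in c * (2 * suc v) ≤ u × c * w ≤ u * z
    bounds w N≤w = go
      where
      l = ⌊log₂ w ⌋
      t = tritsPerWord w

      t-large : (4 * c + 2) * (2 + l) ≤ t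
      t-large = s≤s⁻¹ (*-cancelˡ-≤ 2 (begin
        2 * suc ((4 * c + 2) * (2 + l))
          ≤⟨ *-monoʳ-≤ 2 (+-monoˡ-≤ ((4 * c + 2) * (2 + l)) (s≤s {n = suc l} z≤n)) ⟩
        2 * (2 + l + (4 * c + 2) * (2 + l))         ≡⟨ arrange c l ⟩
        (8 * c + 6) * (2 + l)                       ≤⟨ proj₂ (log≤ (8 * c + 6)) w N≤w ⟩
        w                                           ≤⟨ w≤2+2*trits w ⟩
        2 * suc t                                   ∎))
        where
        arrange : ∀ c l → 2 * (2 + l + (4 * c + 2) * (2 + l)) ≡ (8 * c + 6) * (2 + l)
        arrange = solve-∀

      sum≤t : c * (2 * suc (sumTrits w)) + suc (sumTrits w) ≤ t
      sum≤t = ≤-trans (≤-reflexive (arrange c l)) t-large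
        where
        arrange : ∀ c l → c * (2 * suc (3 + 2 * l)) + suc (3 + 2 * l) ≡ (4 * c + 2) * (2 + l)
        arrange = solve-∀

      go : let open Parameters (parameters w) in c * (2 * suc v) ≤ u × c * w ≤ u * z
      go with sumTrits w <? tritsPerWord w
      ... | no v≮t = contradiction
          (≤-trans (m≤n+m (suc (sumTrits w)) (c * (2 * suc (sumTrits w)))) sum≤t) v≮t
      ... | yes _  = c≤u , *-mono-≤ (≤-trans (m≤m*n c (2 * suc v)) c≤u) (m≤n+m∸n w 1)
        where
        v = sumTrits w
        c≤u : c * (2 * suc v) ≤ t ∸ v
        c≤u = m+n≤o⇒m≤o∸n (c * (2 * suc v)) (≤-trans (+-monoʳ-≤ (c * (2 * suc v)) (n≤1+n v)) sum≤t)

  module _ (w : ℕ → ℕ) (wordSize : WordSize w) where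

    private
      module P n = Parameters (parameters (w n))

      C N₀ : ℕ
      -- The successor makes `C` positive, so that it can be cancelled and `G` is at least 4.
      C  = suc (proj₁ (proj₁ wordSize))
      N₀ = proj₁ (proj₂ (proj₁ wordSize))

      w≤ : ∀ n → N₀ ≤ n → w n ≤ C * ⌊log₂ n ⌋
      w≤ n N₀≤n = ≤-trans (proj₁ (proj₂ (proj₂ (proj₁ wordSize)) n N₀≤n)) (m≤n+m _ ⌊log₂ n ⌋)

      w-unbounded : ∀ W n → 2 ^ W ≤ n → W ≤ w n
      w-unbounded W n 2^W≤n = <⇒≤ (^-cancel-< 2 (begin-strict
        2 ^ W      ≤⟨ 2^W≤n ⟩
        n          ≤⟨ m≤m+n n _ ⟩
        2 * n      <⟨ proj₂ wordSize n ⟩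
        2 ^ w n    ∎))

    2≤w : ∀ {n} → 1 ≤ n → 2 ≤ w n
    2≤w {n} 1≤n = ^-cancel-< 2 (≤-<-trans (*-monoʳ-≤ 2 1≤n) (proj₂ wordSize n))

    square-o : IsLittleO-n (λ n → w n * w n)
    square-o c = N₀ ⊔ 2 ^ L , bound
      where
      L = proj₁ (square≤2^ (c * (C * C)))

      bound : ∀ n → N₀ ⊔ 2 ^ L ≤ n → c * (w n * w n) ≤ n
      bound n N≤n = begin
        c * (w n * w n)          ≤⟨ *-monoʳ-≤ c (*-mono-≤ w≤Cl w≤Cl) ⟩
        c * (C * l * (C * l))    ≡⟨ arrange c C l ⟩
        c * (C * C) * (l * l)    ≤⟨ proj₂ (square≤2^ (c * (C * C))) l (2^l≤n⇒l≤⌊log₂n⌋ 2^L≤n) ⟩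
        2 ^ l                    ≤⟨ 2^⌊log₂n⌋≤n n (≤-trans (m^n>0 2 L) 2^L≤n) ⟩
        n                        ∎
        where
        l     = ⌊log₂ n ⌋
        2^L≤n = m⊔n≤o⇒n≤o N₀ (2 ^ L) N≤n
        w≤Cl  = w≤ n (m⊔n≤o⇒m≤o N₀ (2 ^ L) N≤n)

        arrange : ∀ c C l → c * (C * l * (C * l)) ≡ c * (C * C) * (l * l)
        arrange = solve-∀

    -- As w n ≤ C lg n, each of G pieces of a word has at most (lg n)/4 + 1 trits,
    -- so that a table with an entry for every possible piece has size at most
    -- 3 √n.
    G : ℕ
    G = 4 * C

    pieceTrits : ℕ → ℕ
    pieceTrits n = suc (P.u n / G)

    u≤G*piece : ∀ n → P.u n ≤ G * pieceTrits n
    u≤G*piece n = begin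
      u                      ≡⟨ m≡m%n+[m/n]*n u G ⟩
      u % G + u / G * G      ≤⟨ +-monoˡ-≤ (u / G * G) (<⇒≤ (m%n<n u G)) ⟩
      G + u / G * G          ≡⟨ *-comm (pieceTrits n) G ⟩
      G * pieceTrits n       ∎
      where u = P.u n

    piece≤u : ∀ n → pieceTrits n ≤ P.u n
    piece≤u n = m/n<m (P.u n) G {{P.u≢0 n}} {{_}}
        (s≤s (≤-trans (s≤s z≤n) (m≤n+m (3 * C) (proj₁ (proj₁ wordSize)))))

    u≤w : ∀ {n} → 1 ≤ n → P.u n ≤ w n
    u≤w {n} 1≤n = <⇒≤ (^-cancel-< 2 (begin-strict
      2 ^ u          ≤⟨ ^-monoˡ-≤ u (n≤1+n 2) ⟩
      3 ^ u          ≤⟨ ^-monoʳ-≤ 3 (m≤m+n u (P.v n)) ⟩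
      3 ^ (u + P.v n) <⟨ P.fits n (2≤w 1≤n) ⟩
      2 ^ w n        ∎))
      where u = P.u n

    -- The three terms are fixed parts, tables and padding; the loss in every trit word; and the
    -- group sums. The 15 words are nine of the header, one extra each for trits, sums and powers,
    -- the final one, and two for padding the row encodings.
    redundancy : ℕ → ℕ
    redundancy n = w n * (15 + u + 3 ^ pieceTrits n) + 2 * suc v * (n / u) + w n * (n / u / z)
      where open Parameters (parameters (w n))

    redundancy-o : IsLittleO-n redundancy
    redundancy-o = IsLittleO-+ (IsLittleO-+ tables-o sums-o) groups-o
      where
      piece²≤n : ∀ n → 1 ⊔ N₀ ≤ n → 3 ^ (P.u n / G) * 3 ^ (P.u n / G) ≤ n
      piece²≤n n N≤n = begin
        3 ^ x * 3 ^ x          ≤⟨ *-mono-≤ (^-monoˡ-≤ x (n≤1+n 3)) (^-monoˡ-≤ x (n≤1+n 3)) ⟩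
        4 ^ x * 4 ^ x          ≡⟨ cong₂ _*_ (^-*-assoc 2 2 x) (^-*-assoc 2 2 x) ⟩
        2 ^ (2 * x) * 2 ^ (2 * x)  ≡⟨ ^-distribˡ-+-* 2 (2 * x) (2 * x) ⟨
        2 ^ (2 * x + 2 * x)    ≤⟨ ^-monoʳ-≤ 2 4x≤l ⟩
        2 ^ ⌊log₂ n ⌋          ≤⟨ 2^⌊log₂n⌋≤n n 1≤n ⟩
        n                      ∎
        where
        x   = P.u n / G
        1≤n = m⊔n≤o⇒m≤o 1 N₀ N≤n

        arrange : ∀ C x → C * (2 * x + 2 * x) ≡ x * (4 * C)
        arrange = solve-∀

        4x≤l : 2 * x + 2 * x ≤ ⌊log₂ n ⌋
        4x≤l = *-cancelˡ-≤ C (begin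
          C * (2 * x + 2 * x)     ≡⟨ arrange C x ⟩
          x * G                   ≤⟨ m/n*n≤m (P.u n) G ⟩
          P.u n                   ≤⟨ u≤w 1≤n ⟩
          w n                     ≤⟨ w≤ n (m⊔n≤o⇒n≤o 1 N₀ N≤n) ⟩
          C * ⌊log₂ n ⌋           ∎)

      product-o : IsLittleO-n (λ n → w n * 3 ^ (P.u n / G))
      product-o c = N ⊔ (1 ⊔ N₀) , bound
        where
        N = proj₁ (square-o (c * c))

        bound : ∀ n → N ⊔ (1 ⊔ N₀) ≤ n → c * (w n * 3 ^ (P.u n / G)) ≤ n
        bound n N≤n = begin
          c * (w n * y)    ≡⟨ *-assoc c (w n) y ⟨
          c * w n * y
            ≤⟨ geometric {c * w n} {y} (≤-trans (≤-reflexive (arrange c (w n)))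
                (proj₂ (square-o (c * c)) n (m⊔n≤o⇒m≤o N _ N≤n))) (piece²≤n n (m⊔n≤o⇒n≤o N _ N≤n)) ⟩
          n                ∎
          where
          y = 3 ^ (P.u n / G)

          arrange : ∀ c w → c * w * (c * w) ≡ c * c * (w * w)
          arrange = solve-∀

          -- A product is at most the larger of the two squares; so it suffices that both the word
          -- size with its constant and the root of the table size have squares up to n.
          geometric : ∀ {a b n} → a * a ≤ n → b * b ≤ n → a * b ≤ n
          geometric {a} {b} aa≤n bb≤n with ≤-total a b
          ... | inj₁ a≤b = ≤-trans (*-monoˡ-≤ b a≤b) bb≤n
          ... | inj₂ b≤a = ≤-trans (*-monoʳ-≤ a b≤a) aa≤n

      scale-o : ∀ k {r} → IsLittleO-n r → IsLittleO-n (λ n → k * r n)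
      scale-o k {r} r-o c = proj₁ (r-o (c * k)) , λ n N≤n →
        ≤-trans (≤-reflexive (sym (*-assoc c k (r n)))) (proj₂ (r-o (c * k)) n N≤n)

      tables-o : IsLittleO-n (λ n → w n * (15 + P.u n + 3 ^ pieceTrits n))
      tables-o = IsLittleO-≤ 1 bound (IsLittleO-+ (scale-o 16 square-o) (scale-o 3 product-o))
        where
        bound : ∀ n → 1 ≤ n → w n * (15 + P.u n + 3 ^ pieceTrits n) ≤ 16 * (w n * w n)
            + 3 * (w n * 3 ^ (P.u n / G))
        bound n 1≤n = begin
          w n * (15 + P.u n + 3 * y)
            ≤⟨ *-monoʳ-≤ (w n) (+-monoˡ-≤ (3 * y)
                (+-mono-≤ (m≤m*n 15 (w n) {{>-nonZero (<⇒≤ (2≤w 1≤n))}}) (u≤w 1≤n))) ⟩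
          w n * (15 * w n + w n + 3 * y)       ≡⟨ arrange (w n) y ⟩
          16 * (w n * w n) + 3 * (w n * y)     ∎
          where
          y = 3 ^ (P.u n / G)
          arrange : ∀ w y → w * (15 * w + w + 3 * y) ≡ 16 * (w * w) + 3 * (w * y)
          arrange = solve-∀

      sums-o : IsLittleO-n (λ n → let open Parameters (parameters (w n)) in 2 * suc v * (n / u))
      sums-o c = 2 ^ proj₁ (parameters-asymptotics c) , bound
        where
        bound : ∀ n → 2 ^ proj₁ (parameters-asymptotics c) ≤ n →
                let open Parameters (parameters (w n)) in c * (2 * suc v * (n / u)) ≤ n
        bound n N≤n = begin
          c * (2 * suc v * (n / u))    ≡⟨ *-assoc c (2 * suc v) (n / u) ⟨
          c * (2 * suc v) * (n / u)
            ≤⟨ *-monoˡ-≤ (n / u) (proj₁ (proj₂ (parameters-asymptotics c) (w n)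
                (w-unbounded _ n N≤n))) ⟩
          u * (n / u)                  ≡⟨ *-comm u (n / u) ⟩
          n / u * u                    ≤⟨ m/n*n≤m n u ⟩
          n                            ∎
          where open Parameters (parameters (w n))

      groups-o : IsLittleO-n (λ n → let open Parameters (parameters (w n)) in w n * (n / u / z))
      groups-o c = 2 ^ proj₁ (parameters-asymptotics c) , bound
        where
        bound : ∀ n → 2 ^ proj₁ (parameters-asymptotics c) ≤ n →
                let open Parameters (parameters (w n)) in c * (w n * (n / u / z)) ≤ n
        bound n N≤n = begin
          c * (w n * (n / u / z))    ≡⟨ *-assoc c (w n) (n / u / z) ⟨
          c * w n * (n / u / z)
            ≤⟨ *-monoˡ-≤ (n / u / z) (proj₂ (proj₂ (parameters-asymptotics c) (w n)
                (w-unbounded _ n N≤n))) ⟩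
          u * z * (n / u / z)        ≡⟨ arrange u z (n / u / z) ⟩
          n / u / z * z * u          ≤⟨ *-monoˡ-≤ u (m/n*n≤m (n / u) z) ⟩
          n / u * u                  ≤⟨ m/n*n≤m n u ⟩
          n                          ∎
          where
          open Parameters (parameters (w n))

          arrange : ∀ u z x → u * z * x ≡ x * z * u
          arrange = solve-∀

  -- By `dense`, a word is worth at most u + v + 1 trits. The u trits per word amount to at most m
  -- in all and are paid for by the logarithm; each of the other v + 1 costs at most 2 bits.
  -- Comparing powers of 2 and 3 avoids real logarithms.
  words≤log : ∀ {w m q} (p : Parameters w) → let open Parameters p in
              q * u ≤ m → q * w ≤ ⌈log₂ (3 ^ m) ⌉ + 2 * suc v * q
  words≤log {w} {m} {q} p qu≤m = begin
    q * w                           ≤⟨ m≤n+m∸n (q * w) D ⟩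
    D + (q * w ∸ D)                 ≡⟨ +-comm D _ ⟩
    (q * w ∸ D) + D                 ≤⟨ +-monoˡ-≤ D bits ⟩
    ⌈log₂ (3 ^ m) ⌉ + D             ∎
    where
    open Parameters p
    D = 2 * suc v * q

    power : 2 ^ (q * w) ≤ 3 ^ m * 2 ^ D
    power = begin
      2 ^ (q * w)
        ≡⟨ trans (cong (2 ^_) (*-comm q w)) (sym (^-*-assoc 2 w q)) ⟩
      (2 ^ w) ^ q                        ≤⟨ ^-monoˡ-≤ q dense ⟩
      (3 ^ suc (u + v)) ^ q              ≡⟨ ^-*-assoc 3 (suc (u + v)) q ⟩
      3 ^ (suc (u + v) * q)              ≡⟨ cong (3 ^_) (arrange u v q) ⟩
      3 ^ (q * u + suc v * q)            ≡⟨ ^-distribˡ-+-* 3 (q * u) (suc v * q) ⟩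
      3 ^ (q * u) * 3 ^ (suc v * q)
        ≤⟨ *-mono-≤ (^-monoʳ-≤ 3 qu≤m) (^-monoˡ-≤ (suc v * q) (n≤1+n 3)) ⟩
      3 ^ m * 4 ^ (suc v * q)
        ≡⟨ cong (3 ^ m *_) (trans (^-*-assoc 2 2 (suc v * q))
            (cong (2 ^_) (sym (*-assoc 2 (suc v) q)))) ⟩
      3 ^ m * 2 ^ D                      ∎
      where
      arrange : ∀ u v q → suc (u + v) * q ≡ q * u + suc v * q
      arrange = solve-∀

    bits : q * w ∸ D ≤ ⌈log₂ (3 ^ m) ⌉
    bits with ≤-total (q * w) D
    ... | inj₁ qw≤D = ≤-trans (≤-reflexive (m≤n⇒m∸n≡0 qw≤D)) z≤n
    ... | inj₂ D≤qw = ≤-trans (≤-reflexive (sym (⌈log₂2^n⌉≡n (q * w ∸ D))))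
      (⌈log₂⌉-mono-≤ (*-cancelʳ-≤ (2 ^ (q * w ∸ D)) (3 ^ m) (2 ^ D) {{m^n≢0 2 D}} (begin
        2 ^ (q * w ∸ D) * 2 ^ D    ≡⟨ ^-distribˡ-+-* 2 (q * w ∸ D) D ⟨
        2 ^ (q * w ∸ D + D)        ≡⟨ cong (2 ^_) (m∸n+n≡m D≤qw) ⟩
        2 ^ (q * w)                ≤⟨ power ⟩
        3 ^ m * 2 ^ D              ∎)))

  n/2≡⌊n/2⌋ : ∀ n → n / 2 ≡ ⌊ n /2⌋
  n/2≡⌊n/2⌋ 0             = refl
  n/2≡⌊n/2⌋ 1             = refl
  n/2≡⌊n/2⌋ (suc (suc n)) = trans (m/n≡1+[m∸n]/n {2 + n} {2} (s≤s (s≤s z≤n)))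
      (cong suc (n/2≡⌊n/2⌋ n))

-- Length of the encoding

module _ (w : ℕ → ℕ) (wordSize : WordSize w) {n : ℕ} (1≤n : 1 ≤ n) where

  open Parameters (parameters (w n))

  private
    instance
      w≢0 : NonZero (w n)
      w≢0 = >-nonZero (<⇒≤ (2≤w w wordSize 1≤n))

    τ = pieceTrits w wordSize n

  length-encoding : ∀ f {m S β₁ β₂} → m ≤ n → length β₁ ≤ S → length β₂ ≤ S →
    length (serialise (w n) (Layout.contents (w n) f m u z τ β₁ β₂)) ≤ 2 * S + ⌈log₂ (3 ^ m) ⌉
        + redundancy w wordSize n
  length-encoding f {m} {S} {β₁} {β₂} m≤n β₁≤ β₂≤ = begin
    length (serialise (w n) (Layout.contents (w n) f m u z τ β₁ β₂))
      ≡⟨ trans (length-serialise (w n) (Layout.contents (w n) f m u z τ β₁ β₂))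
          (cong (_* w n) (Layout.length-contents (w n) f m u z τ β₁ β₂)) ⟩
    (9 + (suc (m / u) + (suc (m / u / z) + (3 ^ τ + (suc u + (l₁ + (l₂ + 1))))))) * w n
      ≡⟨ arrange (m / u) (m / u / z) (3 ^ τ) u l₁ l₂ (w n) ⟩
    m / u * w n + w n * (m / u / z) + w n * (13 + u + 3 ^ τ) + (l₁ * w n + l₂ * w n)
      ≤⟨ +-mono-≤ (+-monoˡ-≤ (w n * (13 + u + 3 ^ τ)) (+-mono-≤ trits≤
          (*-monoʳ-≤ (w n) (/-monoˡ-≤ z (/-monoˡ-≤ u m≤n)))))
                  (+-mono-≤ (≤-trans (chunks-bits (w n) β₁) (+-monoˡ-≤ (w n) β₁≤))
                      (≤-trans (chunks-bits (w n) β₂) (+-monoˡ-≤ (w n) β₂≤))) ⟩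
    L + D * (n / u) + w n * (n / u / z) + w n * (13 + u + 3 ^ τ) + (S + w n + (S + w n))
      ≡⟨ arrange′ L (D * (n / u)) (w n * (n / u / z)) (w n) (u + 3 ^ τ) S ⟩
    2 * S + L + (w n * (15 + (u + 3 ^ τ)) + D * (n / u) + w n * (n / u / z))
      ≡⟨ cong (λ x → 2 * S + L + (w n * x + D * (n / u) + w n * (n / u / z)))
          (+-assoc 15 u (3 ^ τ)) ⟨
    2 * S + ⌈log₂ (3 ^ m) ⌉ + redundancy w wordSize n ∎
    where
    open ≤-Reasoning
    l₁ = length (chunks (w n) β₁)
    l₂ = length (chunks (w n) β₂)
    L  = ⌈log₂ (3 ^ m) ⌉
    D  = 2 * suc v

    trits≤ : m / u * w n ≤ L + D * (n / u)
    trits≤ = ≤-trans (words≤log (parameters (w n)) (m/n*n≤m m u))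
        (+-monoʳ-≤ L (*-monoʳ-≤ D (/-monoˡ-≤ u m≤n)))

    arrange : ∀ a g B u l₁ l₂ w → (9 + (suc a + (suc g + (B + (suc u + (l₁ + (l₂ + 1))))))) * w ≡
              a * w + w * g + w * (13 + u + B) + (l₁ * w + l₂ * w)
    arrange = solve-∀
    arrange′ : ∀ L D g w x S → L + D + g + w * (13 + x) + (S + w + (S + w)) ≡ 2 * S + L
        + (w * (15 + x) + D + g)
    arrange′ = solve-∀

-- The encoding of a two-row array and its queries

Holds-takes : ∀ {w n} {m m₁ m₂ : Memory w} {o c d} (ps qs : List (Fin n)) →
              length (take c ps) ≡ c → (∀ a → toℕ a < o + c → m a ≡ m₁ a) → m ≡ m₂ →
              Holds w m₁ o (map pos ps) → Holds w m₂ (o + c) (map pos qs) →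
              Holds w m o (map pos (take c ps ++ take d qs))
Holds-takes {w} {m = m} {m₁} {m₂} {o} {c} {d} ps qs len same refl holds₁ holds₂ =
  subst (Holds w m o) (sym (map-++ pos (take c ps) (take d qs)))
    (HoldsFrom⇒Holds w {m = m} o _ (HoldsFrom-++ w {m = m} (map pos (take c ps))
      (HoldsFrom-frame w {m = m₁} {m} (map pos (take c ps))
        (λ a a< → same a (subst (λ l → toℕ a < o + l) len′ a<))
        (subst (HoldsFrom w m₁ o) (take-map c ps) (HoldsFrom-take w {m = m₁} c (map pos ps)
            (Holds⇒HoldsFrom w {m = m₁} o (map pos ps) holds₁))))
      (subst₂ (λ l → HoldsFrom w m (o + l)) (sym len′) (take-map d qs)
        (HoldsFrom-take w {m = m} d (map pos qs) (Holds⇒HoldsFrom w {m = m} (o + c)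
            (map pos qs) holds₂)))))
  where
  len′ : length (map pos (take c ps)) ≡ c
  len′ = trans (length-map pos (take c ps)) len

module _ {a ℓ₁ ℓ₂} (w : ℕ → ℕ) (wordSize : WordSize w) (O : StrictTotalOrder a ℓ₁ ℓ₂)
         {n k S T : ℕ} {P : Prog} (1≤n : 1 ≤ n) (k≤2n : k ≤ 2 * n)
         (encoding : Sorted1SidedEncoding O (w n) P n k S T)
         (A : Fin 2 × Fin n → StrictTotalOrder.Carrier O) (distinct : DistinctEntries O A) where

  open Parameters (parameters (w n))

  private
    instance
      w≢0 : NonZero (w n)
      w≢0 = >-nonZero (<⇒≤ (2≤w w wordSize 1≤n))

    2≤w′ = 2≤w w wordSize 1≤n
    2n<  = proj₂ wordSize n
    τ    = pieceTrits w wordSize n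
    g    = G w wordSize
    h    = k / 2
    m    = n ∸ h

    -- Here `k ≤ 2 * n` enters: columns up to `h` lie within the array, so that `K` is the identity
    -- there.
    h≤n : h ≤ n
    h≤n = ≤-trans (/-monoˡ-≤ 2 k≤2n) (≤-reflexive (trans (/-congˡ (*-comm 2 n)) (m*n/n≡m n 2)))

    rowEncoding : ∀ r → _
    rowEncoding r = encoding (A ∘ (r ,_)) λ eq → cong proj₂ (distinct eq)

    β : Fin 2 → BitString
    β r = proj₁ (rowEncoding r)

    K : ℕ → ℕ
    K = topCount O A k zero

    K≤h : ∀ {b} → b ≤ h → K b ≡ b
    K≤h {b} b≤h = topCount-all O A k (≤-trans b≤h h≤n)
      (≤-trans (+-mono-≤ b≤h (≤-trans b≤h (≤-reflexive (sym (+-identityʳ h)))))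
               (≤-trans (≤-reflexive (*-comm 2 h)) (m/n*n≤m k 2)))

  open Differences K h (topCount-suc O A k zero) (topCount-pred O A k) K≤h

  private
    module L = Layout (w n) trit m u z τ (β zero) (β (suc zero))

  twoRowEncoding : BitString
  twoRowEncoding = serialise (w n) L.contents

  length-twoRowEncoding : length twoRowEncoding ≤ 2 * S + ⌈log₂ (3 ^ (n ∸ ⌊ k /2⌋)) ⌉
      + redundancy w wordSize n
  length-twoRowEncoding = subst (λ h → length twoRowEncoding ≤ 2 * S + ⌈log₂ (3 ^ (n ∸ h)) ⌉
      + redundancy w wordSize n) (n/2≡⌊n/2⌋ k)
    (length-encoding w wordSize 1≤n trit (m∸n≤m n h) (proj₁ (proj₂ (rowEncoding zero)))
        (proj₁ (proj₂ (rowEncoding (suc zero)))))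

  module _ {i j b} (1≤i : 1 ≤ i) (i≤j : i ≤ j) (j≤2 : j ≤ 2) (1≤b : 1 ≤ b) (b≤n : b ≤ n) where

    private
      c d : ℕ
      c = count₁ k i j b (K b)
      d = count₂ k i j b (K b)

      c≤n : c ≤ n
      c≤n = ≤-trans (count₁-≤ k i j (topCount-≤ O A k zero b)) b≤n

      evaluates : ∀ (rom : Memory (w n)) {M e o σ₀} (stored : StoredAt (w n) rom e twoRowEncoding) →
          o + 2 * n ≤ 2 ^ w n →
        RegsFrom σ₀ M (n ∷ k ∷ i ∷ j ∷ b ∷ e ∷ o ∷ []) →
        Pointwise (Evaluation._⇝_ rom σ₀ M (7 + M)) (queryᵉ g)
            (c ∷ d ∷ e + L.at₄ ∷ e + L.at₅ ∷ o + c ∷ [])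
      evaluates rom {M} {e} {o} {σ₀} stored room args =
        query⇝ (subst (Evaluation._⇝_ rom σ₀ M (7 + M) (topCountᵉ g)) (recover b)
                 (topCount⇝ (u≤G*piece w wordSize n) 2<
                   (≤-<-trans (*-monoʳ-≤ 2 (≤-trans (m∸n≤m b h) b≤n)) 2n<) (∸-monoˡ-≤ h b≤n)))
               (topCount-≤ O A k zero b) 2< total< o+c<
        where
        module E = L.Stored.Query rom e stored trit≤2
          (≤-<-trans (^-monoʳ-≤ 3 (m≤m+n u v)) (fits 2≤w′)) (z< 2≤w′) (piece≤u w wordSize n)
          (λ j → <-trans (tritWord-< trit u z trit≤2 small j) (fits 2≤w′))
          (≤-<-trans (≤-trans (*-monoˡ-≤ 2 (m∸n≤m n h)) (≤-reflexive (*-comm n 2))) 2n<)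
        open E.Arguments {σ₀} {M} {n} {k} {i} {j} {b} {o} args

        2< : 2 < 2 ^ w n
        2< = ≤-<-trans (*-monoʳ-≤ 2 1≤n) 2n<

        total< : (j ∸ i) * b + b < 2 ^ w n
        total< = ≤-<-trans (≤-trans (+-mono-≤ (*-mono-≤ (≤-trans (∸-mono j≤2 1≤i) ≤-refl) b≤n) b≤n)
            (≤-reflexive (+-comm (1 * n) n))) 2n<

        o+c< : o + c < 2 ^ w n
        o+c< = ≤-trans (+-monoʳ-< o (≤-<-trans c≤n (m<m+n n (≤-trans 1≤n (m≤m+n n 0))))) room

      RowAnswer : Fin 2 → ℕ → State (w n) → Set ℓ₂
      RowAnswer r o σ′ = Σ (List (Fin n)) λ ps →
        TopK₁ O k 1 b (A ∘ (r ,_)) ps × Decreasing O (A ∘ (r ,_)) ps ×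
            Holds (w n) (out σ′) o (map pos ps)

      Answer : ℕ → State (w n) → Set ℓ₂
      Answer o σ′ = Σ (List (Fin n)) λ cs → Σ (List (Fin n)) λ ds →
        TopK₂ O k i j 1 b A (map (zero ,_) cs ++ map (suc zero ,_) ds) ×
        RegsHold σ′ (length cs ∷ length ds ∷ []) ×
        Holds (w n) (out σ′) o (map pos (cs ++ ds))

      combine : ∀ {o} {σ′ σ₁ σ₂ : State (w n)} → RegsHold σ′ (c ∷ d ∷ []) →
                RowAnswer zero o σ₁ → (∀ a → toℕ a < o + c → out σ′ a ≡ out σ₁ a) →
                RowAnswer (suc zero) (o + c) σ₂ → out σ′ ≡ out σ₂ → Answer o σ′
      combine {o} {σ′} {σ₁} {σ₂} regs (ps , top₁ , dec₁ , holds₁) same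
          (qs , top₂ , dec₂ , holds₂) outs =
          take c ps , take d qs , proj₁ answer
        , subst₂ (λ x y → RegsHold {w n} σ′ (x ∷ y ∷ [])) (sym (proj₁ (proj₂ answer)))
            (sym (proj₂ (proj₂ answer))) regs
        , Holds-takes {w = w n} {m = out σ′} {out σ₁} {out σ₂} ps qs
            (proj₁ (proj₂ answer)) same outs holds₁ holds₂
        where answer = answers O A distinct k b≤n top₁ dec₁ top₂ dec₂ (rows 1≤i i≤j j≤2)

      finish : ∀ {rom : Memory (w n)} {σ o t} {Q : Prog} →
        (Σ (State (w n)) λ σ′ → Σ ℕ λ s → (rom ⊢ Q , σ ⇓ σ′ [ s ]) × s ≤ t ×
          (∀ a → toℕ a < o → out σ′ a ≡ out σ a) × RegsHold σ′ (c ∷ d ∷ []) ×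
          Σ (State (w n)) λ σ₁ → RowAnswer zero o σ₁ × (∀ a → toℕ a < o + c → out σ′ a ≡ out σ₁ a) ×
          Σ (State (w n)) λ σ₂ → RowAnswer (suc zero) (o + c) σ₂ × out σ′ ≡ out σ₂) →
        Σ (State (w n)) λ σ′ → Σ ℕ λ s → (rom ⊢ Q , σ ⇓ σ′ [ s ]) × s ≤ t ×
          (∀ a → toℕ a < o → out σ′ a ≡ out σ a) × Answer o σ′
      finish (σ′ , s , run , s≤ , below , regs , σ₁ , ans₁ , same , σ₂ , ans₂ , outs) =
        σ′ , s , run , s≤ , below , combine {σ′ = σ′} {σ₁} {σ₂} regs ans₁ same ans₂ outs

    answers-query : Computes (w n) (callTwice (queryᵉ g) P) twoRowEncoding
        (n ∷ k ∷ i ∷ j ∷ b ∷ []) (2 * n)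
                      (2 * T + overhead (queryᵉ g)) Answer
    answers-query rom σ e o stored room hold = finish
      (callTwice-correct (queryᵉ g) {Post₁ = RowAnswer zero} {RowAnswer (suc zero)}
        (proj₂ (proj₂ (rowEncoding zero)) b 1≤b b≤n)
            (proj₂ (proj₂ (rowEncoding (suc zero))) b 1≤b b≤n)
        rom σ hold (λ σ₀ → evaluates rom {σ₀ = σ₀} stored room)
        (L.Stored.β₁-at rom e stored) (L.Stored.β₂-at rom e stored)
        -- At most n positions of the first answer are kept and the second call needs n cells, which
        -- fits into the 2n available.
        (≤-trans (≤-reflexive (+-assoc o c n)) (≤-trans (+-monoʳ-≤ o (≤-trans (+-monoˡ-≤ n c≤n)
          (≤-reflexive (cong (n +_) (sym (+-identityʳ n)))))) room)))

theorem1 :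
    ∀ {a ℓ₁ ℓ₂} (w : ℕ → ℕ) → WordSize w →
    Σ (ℕ → ℕ) λ r → IsLittleO-n r × ∃ λ c →
    ∀ (S T : ℕ → ℕ → ℕ) (P : Prog) → ∃ λ (Q : Prog) →
    ∀ (O : StrictTotalOrder a ℓ₁ ℓ₂) (n k : ℕ) → 1 ≤ n → 1 < k → k ≤ 2 * n →
    Sorted1SidedEncoding O (w n) P n k (S n k) (T n k) →
    Unsorted3SidedEncoding O (w n) Q n k
      (2 * S n k + ⌈log₂ (3 ^ (n ∸ ⌊ k /2⌋)) ⌉ + r n)
      (2 * T n k + c)
theorem1 w wordSize =
  redundancy w wordSize , redundancy-o w wordSize , overhead (queryᵉ (G w wordSize)) , λ S T P →
  -- Built from `P` and the number of pieces, which stems from the word size alone; all that varies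
  -- with n and k is read from the header or the arguments.
  callTwice (queryᵉ (G w wordSize)) P , λ O n k 1≤n _ k≤2n encoding A distinct →
    twoRowEncoding w wordSize O 1≤n k≤2n encoding A distinct
  , length-twoRowEncoding w wordSize O 1≤n k≤2n encoding A distinct
  , λ i j b 1≤i i≤j j≤2 1≤b b≤n →
      answers-query w wordSize O 1≤n k≤2n encoding A distinct 1≤i i≤j j≤2 1≤b b≤n
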